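{- Let $T$ be a tree on $n$ vertices that has a perfect matching and has diameter $D\geq 5$. Let $P=v_0v_1\ldots v_D$ be a diametric path in $T$ and let $w_1,\ldots,w_k$ be all vertices in $V(T)\setminus\{v_3\}$ that are adjacent to $v_2$ and have degree $2$. Let $T'$ be the tree obtained from $T$ by deleting the edges $v_2w_1,\ldots,v_2w_k$ and adding the edges $v_3w_1,\ldots,v_3w_k$. Then $T'$ is a tree on $n$ vertices which has a perfect matching, and $\xi^{ac}(T)<\xi^{ac}(T')$.
   Context: A matching is a set of edges no two sharing a vertex; it is perfect if every vertex is incident to an edge of it. $d(u,v)$ is the distance, $\varepsilon(u)=\max_v d(u,v)$ the eccentricity, the diameter $D$ the maximum distance, and a path $v_0\ldots v_D$ with $d(v_0,v_D)=D$ is diametric. $M(u)$ is the product of the degrees of all neighbors of $u$, and $\xi^{ac}(G)=\sum_{u\in V(G)}\frac{M(u)}{\varepsilon(u)}$. -}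

module Defs where

open import Data.Bool using (Bool; true; false; if_then_else_; _∧_; _∨_; not)
open import Data.Nat using (ℕ; zero; suc; _≤_; _⊔_; _+_)
open import Data.Fin using (Fin)
open import Data.Fin.Properties using (_≟_)
open import Data.List using (List; []; _∷_; map; allFin; foldr; length; _++_; [_])
open import Data.List.Relation.Unary.Unique.Propositional using (Unique)
open import Data.List.Relation.Unary.Linked using (Linked)
open import Data.Product using (Σ; ∃; _×_)
open import Relation.Nullary using (¬_; does)
open import Relation.Binary.PropositionalEquality using (_≡_)
open import Data.Integer using (+_)
open import Data.Rational as ℚ using (ℚ; 0ℚ)
import Data.Nat as N
open import Data.Bool.ListAction using (any)
open import Data.Nat.ListAction using (sum; product)

Graph : ℕ → Set
Graph n = Fin n → Fin n → Bool

module _ {n : ℕ} (G : Graph n) where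

  Adj : Fin n → Fin n → Set
  Adj u v = G u v ≡ true

  IsSimple : Set
  IsSimple = (∀ u v → G u v ≡ G v u) × (∀ u → G u u ≡ false)

  walkB : ℕ → Fin n → Fin n → Bool
  walkB zero    u v = does (u ≟ v)
  walkB (suc k) u v = any (λ w → G u w ∧ walkB k w v) (allFin n)

  Connected : Set
  Connected = ∀ u v → ∃ λ k → walkB k u v ≡ true

  Cycle : Set
  Cycle = Σ (Fin n) λ x → Σ (List (Fin n)) λ ys →
            2 ≤ length ys × Unique (x ∷ ys) × Linked Adj (x ∷ ys ++ [ x ])

  Acyclic : Set
  Acyclic = ¬ Cycle

  IsTree : Set
  IsTree = IsSimple × Connected × Acyclic

  HasPerfectMatching : Set
  HasPerfectMatching = Σ (Fin n → Fin n → Bool) λ M →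
      (∀ u v → M u v ≡ M v u)
    × (∀ u v → M u v ≡ true → G u v ≡ true)
    × (∀ u → ∃ λ v → M u v ≡ true × (∀ w → M u w ≡ true → w ≡ v))

  deg : Fin n → ℕ
  deg u = sum (map (λ v → if G u v then 1 else 0) (allFin n))

  -- distance: least k with a walk of length k (searching k = 0 .. n-1;
  -- in a connected graph on n vertices the distance is < n)
  dist : Fin n → Fin n → ℕ
  dist u v = go 0 n
    where
    go : ℕ → ℕ → ℕ
    go k zero    = k
    go k (suc f) = if walkB k u v then k else go (suc k) f

  ecc : Fin n → ℕ
  ecc u = foldr _⊔_ 0 (map (dist u) (allFin n))

  IsDiameter : ℕ → Set
  IsDiameter D = (∀ u v → dist u v ≤ D) × (∃ λ u → ∃ λ v → dist u v ≡ D)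

  IsDiametricPath : ℕ → (ℕ → Fin n) → Set
  IsDiametricPath D P =
      (∀ i → suc i ≤ D → Adj (P i) (P (suc i)))
    × (∀ i j → i ≤ D → j ≤ D → P i ≡ P j → i ≡ j)
    × dist (P 0) (P D) ≡ D

  Mprod : Fin n → ℕ
  Mprod u = product (map (λ v → if G u v then deg v else 1) (allFin n))

  -- a / e as a rational; e = 0 never occurs for the graphs considered (n ≥ 2, connected)
  frac : ℕ → ℕ → ℚ
  frac a zero    = 0ℚ
  frac a (suc e) = (+ a) ℚ./ suc e

  ξac : ℚ
  ξac = foldr ℚ._+_ 0ℚ (map (λ u → frac (Mprod u) (ecc u)) (allFin n))

  -- w is adjacent to a (= v2), w ≠ b (= v3), deg w = 2
  isW : Fin n → Fin n → Fin n → Bool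
  isW a b w = G a w ∧ not (does (w ≟ b)) ∧ does (deg w N.≟ 2)

  move : Fin n → Fin n → Graph n
  move a b x y =
    if (does (x ≟ a) ∧ isW a b y) ∨ (does (y ≟ a) ∧ isW a b x) then false
    else if (does (x ≟ b) ∧ isW a b y) ∨ (does (y ≟ b) ∧ isW a b x) then true
    else G x y

{-# OPTIONS --safe #-}
module Submission where

-- Hang T from v_D.  Since no vertex lies deeper than v_0, and no vertex can be matched to two
-- leaves, the neighbours of v_2 other than v_3 are w_1, …, w_k, each with exactly one further
-- neighbour (a leaf), and ε ≤ 1 leaves.  Moving the w_i to v_3 keeps the matching, keeps the
-- heights strictly decreasing towards the (new) parents, and does not increase any
-- eccentricity; the eccentricities of v_3 and the w_i become at most D − 2.
--
-- With b = deg v_3, K = ∏ deg w_i ≥ 1 + k, and Q the product of the degrees of the neighbours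
-- of v_3 other than v_2, the degree products change as follows: v_2 from b K to b + k, the
-- leaf at v_2 from 1 + k + ε to 1 + ε, v_3 from (1 + k + ε) Q to (1 + ε) K Q, and each w_i from
-- 1 + k + ε to b + k; all others do not decrease.  The two losses occur at eccentricity at
-- least D − 2, the two gains at eccentricity at most D − 2, so it suffices to compare the
-- numerators.  That comparison needs Q ≥ 2 and Q ≥ b − 1, and Q ≥ b when ε = 0: at most one
-- neighbour of v_3 is a leaf, namely its mate, and for ε = 0 this mate is v_2.  The inequality
-- is strict because the eccentricity of v_1, one of the w_i, drops from D − 1.

open import Defs
open import Algebra.Structures using (IsCommutativeMonoid)
open import Data.Bool using (Bool; true; false; if_then_else_; _∧_; _∨_; not)
open import Data.Bool.Properties using (T-≡; ∧-identityʳ; ∧-zeroʳ; ∨-comm; ∨-identityʳ; ∨-zeroʳ)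
open import Data.Empty using (⊥-elim)
open import Data.Fin using (Fin; zero; suc; toℕ)
open import Data.Fin.Properties using (_≟_; injective⇒≤; toℕ-injective; toℕ<n)
import Data.Integer as ℤ
import Data.Integer.Properties as ℤ
open import Data.List using (List; []; _∷_; map; allFin; foldr; tabulate; length; _++_; [_])
import Data.List.Membership.DecPropositional as DecMembership
open import Data.List.Membership.Propositional using (_∈_; _∉_; lose)
open import Data.List.Membership.Propositional.Properties using (∈-allFin)
open import Data.List.Properties using (map-cong; map-tabulate)
open import Data.List.Relation.Unary.All as All using (All; []; _∷_)
open import Data.List.Relation.Unary.All.Properties using (¬Any⇒All¬)
open import Data.List.Relation.Unary.AllPairs using ([]; _∷_)
open import Data.List.Relation.Unary.Any as Any using (here; there)
open import Data.List.Relation.Unary.Any.Properties using (any⁺; any⁻)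
open import Data.List.Relation.Unary.Linked using (Linked; [-]; _∷_)
open import Data.List.Relation.Unary.Unique.Propositional using (Unique)
open import Data.Nat hiding (_≟_)
import Data.Nat as ℕ
open import Data.Nat.ListAction using (sum; product)
open import Data.Nat.Properties hiding (_≟_)
open import Data.Nat.Tactic.RingSolver using (solve-∀)
open import Data.Product using (∃; _×_; _,_; proj₁; proj₂)
open import Data.Rational as ℚ using (ℚ; 0ℚ)
import Data.Rational.Properties as ℚ
import Data.Rational.Unnormalised as ℚᵘ
import Data.Rational.Unnormalised.Properties as ℚᵘ
open import Data.Sum as Sum using (_⊎_; inj₁; inj₂)
open import Function using (id; Equivalence)
open import Relation.Binary.Construct.Closure.ReflexiveTransitive using (Star; _◅_; _◅◅_; reverse) renaming (ε to ε⋆)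
open import Relation.Binary.PropositionalEquality hiding ([_])
open import Relation.Nullary using (¬_; Dec; does; yes; no; contradiction)
open import Relation.Nullary.Decidable using (dec-true; dec-false; _⊎-dec_)

-- Sums, products and fractions

module Fold {A : Set} {_∙_ : A → A → A} {ε : A} (isCM : IsCommutativeMonoid _≡_ _∙_ ε) where

  open IsCommutativeMonoid isCM using (assoc; comm; identityˡ; identityʳ)

  fold : ∀ {n} → (Fin n → A) → A
  fold {n} f = foldr _∙_ ε (map f (allFin n))

  fold-cong : ∀ {n} {f g : Fin n → A} → (∀ x → f x ≡ g x) → fold f ≡ fold g
  fold-cong {n} f≗g = cong (foldr _∙_ ε) (map-cong f≗g (allFin n))

  interchange : ∀ a b c d → (a ∙ b) ∙ (c ∙ d) ≡ (a ∙ c) ∙ (b ∙ d)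
  interchange a b c d = begin
    (a ∙ b) ∙ (c ∙ d)  ≡⟨ assoc a b (c ∙ d) ⟩
    a ∙ (b ∙ (c ∙ d))  ≡⟨ cong (a ∙_) (sym (assoc b c d)) ⟩
    a ∙ ((b ∙ c) ∙ d)  ≡⟨ cong (λ t → a ∙ (t ∙ d)) (comm b c) ⟩
    a ∙ ((c ∙ b) ∙ d)  ≡⟨ cong (a ∙_) (assoc c b d) ⟩
    a ∙ (c ∙ (b ∙ d))  ≡⟨ sym (assoc a c (b ∙ d)) ⟩
    (a ∙ c) ∙ (b ∙ d)  ∎
    where open ≡-Reasoning

  fold-∙ : ∀ {n} (f g : Fin n → A) → fold (λ x → f x ∙ g x) ≡ fold f ∙ fold g
  fold-∙ {n} f g = go (allFin n)
    where
    go : ∀ xs → foldr _∙_ ε (map (λ x → f x ∙ g x) xs)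
              ≡ foldr _∙_ ε (map f xs) ∙ foldr _∙_ ε (map g xs)
    go []       = sym (identityˡ ε)
    go (x ∷ xs) = trans (cong ((f x ∙ g x) ∙_) (go xs)) (interchange _ _ _ _)

  fold-single : ∀ {n} (p : Fin n) (c : A) → fold (λ x → if does (x ≟ p) then c else ε) ≡ c
  -- As a tabulation the sum unfolds along `Fin`, which permits induction on p.
  fold-single {n} p c = trans (cong (foldr _∙_ ε) (map-tabulate {n = n} id (λ x → if does (x ≟ p) then c else ε))) (go n p)
    where
    const-ε : ∀ n → foldr _∙_ ε (tabulate {n = n} (λ _ → ε)) ≡ ε
    const-ε zero    = refl
    const-ε (suc n) = trans (identityˡ _) (const-ε n)

    go : ∀ n (p : Fin n) → foldr _∙_ ε (tabulate (λ x → if does (x ≟ p) then c else ε)) ≡ c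
    go (suc n) zero    = trans (cong (c ∙_) (const-ε n)) (identityʳ c)
    go (suc n) (suc p) = trans (identityˡ _) (go n p)

open Fold +-0-isCommutativeMonoid
  using () renaming (fold to Σ⟨_⟩; fold-cong to Σ-cong; fold-∙ to Σ-+; fold-single to Σ-single)
open Fold *-1-isCommutativeMonoid
  using () renaming (fold to Π⟨_⟩; fold-cong to Π-cong; fold-∙ to Π-*; fold-single to Π-single)
open Fold ℚ.+-0-isCommutativeMonoid
  using () renaming (fold to Σℚ; fold-cong to Σℚ-cong; fold-∙ to Σℚ-+)

Σ-mono : ∀ {n} {f g : Fin n → ℕ} → (∀ x → f x ≤ g x) → Σ⟨ f ⟩ ≤ Σ⟨ g ⟩
Σ-mono {n} {f} {g} f≤g = go (allFin n)
  where
  go : ∀ xs → sum (map f xs) ≤ sum (map g xs)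
  go []       = z≤n
  go (x ∷ xs) = +-mono-≤ (f≤g x) (go xs)

Π-mono : ∀ {n} {f g : Fin n → ℕ} → (∀ x → f x ≤ g x) → Π⟨ f ⟩ ≤ Π⟨ g ⟩
Π-mono {n} {f} {g} f≤g = go (allFin n)
  where
  go : ∀ xs → product (map f xs) ≤ product (map g xs)
  go []       = ≤-refl
  go (x ∷ xs) = *-mono-≤ (f≤g x) (go xs)

Σ-if : ∀ {n} (p : Fin n → Bool) (c : ℕ) →
       Σ⟨ (λ x → if p x then c else 0) ⟩ ≡ Σ⟨ (λ x → if p x then 1 else 0) ⟩ * c
Σ-if {n} p c = go (allFin n)
  where
  go : ∀ xs → sum (map (λ x → if p x then c else 0) xs)
            ≡ sum (map (λ x → if p x then 1 else 0) xs) * c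
  go []       = refl
  go (x ∷ xs) with p x
  ... | true  = cong (c +_) (go xs)
  ... | false = go xs

term≤Σ : ∀ {n} (f : Fin n → ℕ) (p : Fin n) → f p ≤ Σ⟨ f ⟩
term≤Σ f p = subst (_≤ Σ⟨ f ⟩) (Σ-single p (f p)) (Σ-mono le)
  where
  le : ∀ x → (if does (x ≟ p) then f p else 0) ≤ f x
  le x with x ≟ p
  ... | yes refl = ≤-refl
  ... | no  _    = z≤n

-- Expanding ∏ (1 + tₓ) and keeping only the terms of degree at most one.
Σ<Π : ∀ {n} {t f : Fin n → ℕ} → (∀ x → t x < f x) → Σ⟨ t ⟩ < Π⟨ f ⟩
Σ<Π {n} {t} {f} t<f = go (allFin n)
  where
  go : ∀ xs → sum (map t xs) < product (map f xs)
  go []       = s≤s z≤n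
  go (x ∷ xs) = begin
    1 + (t x + s)             ≤⟨ +-monoʳ-≤ 1 (+-monoʳ-≤ (t x) (m≤m+n s (t x * s))) ⟩
    1 + (t x + (s + t x * s)) ≡⟨ factor (t x) s ⟩
    suc (t x) * suc s         ≤⟨ *-mono-≤ (t<f x) (go xs) ⟩
    f x * product (map f xs)  ∎
    where
    open ≤-Reasoning
    s = sum (map t xs)
    factor : ∀ a s → 1 + (a + (s + a * s)) ≡ suc a * suc s
    factor = solve-∀

Σℚ-mono-< : ∀ {n} {f g : Fin n → ℚ} (p : Fin n) →
            (∀ x → f x ℚ.≤ g x) → f p ℚ.< g p → Σℚ f ℚ.< Σℚ g
Σℚ-mono-< {n} {f} {g} p f≤g fp<gp = strict (∈-allFin p)
  where
  S : (Fin n → ℚ) → List (Fin n) → ℚ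
  S h xs = foldr ℚ._+_ 0ℚ (map h xs)

  weak : ∀ xs → S f xs ℚ.≤ S g xs
  weak []       = ℚ.≤-refl
  weak (x ∷ xs) = ℚ.+-mono-≤ (f≤g x) (weak xs)

  strict : ∀ {xs} → p ∈ xs → S f xs ℚ.< S g xs
  strict {_ ∷ xs} (here refl)  = ℚ.+-mono-<-≤ fp<gp (weak xs)
  strict {x ∷ _}  (there p∈xs) = ℚ.+-mono-≤-< (f≤g x) (strict p∈xs)

-- Abstract, because unfolding the normalisation of fractions is expensive.
abstract
  _÷_ : ℕ → (e : ℕ) .{{_ : NonZero e}} → ℚ
  a ÷ e = ℤ.+ a ℚ./ e

  ÷-def : ∀ a e → a ÷ suc e ≡ ℤ.+ a ℚ./ suc e
  ÷-def a e = refl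

  toℚᵘ-÷ : ∀ a e → ℚ.toℚᵘ (a ÷ suc e) ℚᵘ.≃ ℚᵘ.mkℚᵘ (ℤ.+ a) e
  toℚᵘ-÷ a e = ℚ.toℚᵘ-fromℚᵘ (ℚᵘ.mkℚᵘ (ℤ.+ a) e)

÷-mono : ∀ {a b d e} .{{_ : NonZero d}} .{{_ : NonZero e}} → a ≤ b → e ≤ d → a ÷ d ℚ.≤ b ÷ e
÷-mono {a} {b} {suc d} {suc e} a≤b e≤d = ℚ.toℚᵘ-cancel-≤
  (ℚᵘ.≤-respˡ-≃ (ℚᵘ.≃-sym (toℚᵘ-÷ a d)) (ℚᵘ.≤-respʳ-≃ (ℚᵘ.≃-sym (toℚᵘ-÷ b e))
    (ℚᵘ.*≤* (subst₂ ℤ._≤_ (ℤ.pos-* a (suc e)) (ℤ.pos-* b (suc d)) (ℤ.+≤+ (*-mono-≤ a≤b e≤d))))))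

÷-monoʳ-< : ∀ {a d e} .{{_ : NonZero a}} .{{_ : NonZero d}} .{{_ : NonZero e}} →
            e < d → a ÷ d ℚ.< a ÷ e
÷-monoʳ-< {a} {suc d} {suc e} e<d = ℚ.toℚᵘ-cancel-<
  (ℚᵘ.<-respˡ-≃ (ℚᵘ.≃-sym (toℚᵘ-÷ a d)) (ℚᵘ.<-respʳ-≃ (ℚᵘ.≃-sym (toℚᵘ-÷ a e))
    (ℚᵘ.*<* (subst₂ ℤ._<_ (ℤ.pos-* a (suc e)) (ℤ.pos-* a (suc d)) (ℤ.+<+ (*-monoʳ-< a e<d))))))

÷-+ : ∀ a b e .{{_ : NonZero e}} → (a + b) ÷ e ≡ a ÷ e ℚ.+ b ÷ e
÷-+ a b (suc e) = ℚ.toℚᵘ-injective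
  (ℚᵘ.≃-trans (toℚᵘ-÷ (a + b) e)
  (ℚᵘ.≃-trans (ℚᵘ.*≡* same)
  (ℚᵘ.≃-trans (ℚᵘ.≃-sym (ℚᵘ.+-cong (toℚᵘ-÷ a e) (toℚᵘ-÷ b e)))
              (ℚᵘ.≃-sym (ℚ.toℚᵘ-homo-+ (a ÷ suc e) (b ÷ suc e))))))
  where
  s = ℤ.+ suc e
  same : ℤ.+ (a + b) ℤ.* (s ℤ.* s) ≡ (ℤ.+ a ℤ.* s ℤ.+ ℤ.+ b ℤ.* s) ℤ.* s
  same = trans (sym (ℤ.*-assoc (ℤ.+ (a + b)) s s)) (cong (ℤ._* s) (ℤ.*-distribʳ-+ s (ℤ.+ a) (ℤ.+ b)))

0÷ : ∀ e .{{_ : NonZero e}} → 0 ÷ e ≡ 0ℚ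
0÷ (suc e) = ℚ.toℚᵘ-injective (ℚᵘ.≃-trans (toℚᵘ-÷ 0 e) (ℚᵘ.*≡* refl))

Σℚ-÷ : ∀ {n} (f : Fin n → ℕ) e .{{_ : NonZero e}} → Σℚ (λ x → f x ÷ e) ≡ Σ⟨ f ⟩ ÷ e
Σℚ-÷ {n} f e = go (allFin n)
  where
  go : ∀ xs → foldr ℚ._+_ 0ℚ (map (λ x → f x ÷ e) xs) ≡ sum (map f xs) ÷ e
  go []       = sym (0÷ e)
  go (x ∷ xs) = trans (cong (f x ÷ e ℚ.+_) (go xs)) (sym (÷-+ (f x) (sum (map f xs)) e))

+0÷ : ∀ q c .{{_ : NonZero c}} → q ℚ.+ 0 ÷ c ≡ q
+0÷ q c = trans (cong (q ℚ.+_) (0÷ c)) (ℚ.+-identityʳ q)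

-- Used with c = D - 2. The gain g arises over e′ ≤ c, so g / c underestimates it. The summand
-- `0 ÷ c` gives the right side the shape of `after`.
÷-gain : ∀ {m m′ g e e′ c} .{{_ : NonZero e}} .{{_ : NonZero e′}} .{{_ : NonZero c}} →
         m + g ≤ m′ → e′ ≤ e → e′ ≤ c → m ÷ e ℚ.+ g ÷ c ℚ.≤ m′ ÷ e′ ℚ.+ 0 ÷ c
÷-gain {m} {m′} {g} {e} {e′} {c} m+g≤m′ e′≤e e′≤c = begin
  m ÷ e ℚ.+ g ÷ c    ≤⟨ ℚ.+-mono-≤ (÷-mono (≤-refl {m}) e′≤e) (÷-mono (≤-refl {g}) e′≤c) ⟩
  m ÷ e′ ℚ.+ g ÷ e′  ≡⟨ ÷-+ m g e′ ⟨
  (m + g) ÷ e′       ≤⟨ ÷-mono m+g≤m′ (≤-refl {e′}) ⟩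
  m′ ÷ e′            ≡⟨ +0÷ (m′ ÷ e′) c ⟨
  m′ ÷ e′ ℚ.+ 0 ÷ c  ∎
  where open ℚ.≤-Reasoning

÷-gain-< : ∀ {m m′ g e e′ c} .{{_ : NonZero m}} .{{_ : NonZero e}} .{{_ : NonZero e′}} .{{_ : NonZero c}} →
           m + g ≤ m′ → e′ < e → e′ ≤ c → m ÷ e ℚ.+ g ÷ c ℚ.< m′ ÷ e′ ℚ.+ 0 ÷ c
÷-gain-< {m} {m′} {g} {e} {e′} {c} m+g≤m′ e′<e e′≤c = begin-strict
  m ÷ e ℚ.+ g ÷ c    <⟨ ℚ.+-mono-<-≤ (÷-monoʳ-< {m} e′<e) (÷-mono (≤-refl {g}) e′≤c) ⟩
  m ÷ e′ ℚ.+ g ÷ e′  ≡⟨ ÷-+ m g e′ ⟨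
  (m + g) ÷ e′       ≤⟨ ÷-mono m+g≤m′ (≤-refl {e′}) ⟩
  m′ ÷ e′            ≡⟨ +0÷ (m′ ÷ e′) c ⟨
  m′ ÷ e′ ℚ.+ 0 ÷ c  ∎
  where open ℚ.≤-Reasoning

-- Dual to `÷-gain`: the loss l arises over e ≥ c, so l / c overestimates it.
÷-loss : ∀ {m m′ l e e′ c} .{{_ : NonZero e}} .{{_ : NonZero e′}} .{{_ : NonZero c}} →
         m ≤ m′ + l → e′ ≤ e → c ≤ e → m ÷ e ℚ.+ 0 ÷ c ℚ.≤ m′ ÷ e′ ℚ.+ l ÷ c
÷-loss {m} {m′} {l} {e} {e′} {c} m≤m′+l e′≤e c≤e = begin
  m ÷ e ℚ.+ 0 ÷ c    ≡⟨ +0÷ (m ÷ e) c ⟩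
  m ÷ e              ≤⟨ ÷-mono m≤m′+l (≤-refl {e}) ⟩
  (m′ + l) ÷ e       ≡⟨ ÷-+ m′ l e ⟩
  m′ ÷ e ℚ.+ l ÷ e   ≤⟨ ℚ.+-mono-≤ (÷-mono (≤-refl {m′}) e′≤e) (÷-mono (≤-refl {l}) c≤e) ⟩
  m′ ÷ e′ ℚ.+ l ÷ c  ∎
  where open ℚ.≤-Reasoning

-- Distances and acyclicity

search : (ℕ → Bool) → ℕ → ℕ → ℕ
search p k zero    = k
search p k (suc f) = if p k then k else search p (suc k) f

-- The auxiliary function of dist has no name outside Defs; the omitted left-hand side
-- below is solved to it, which generalises both counters and makes induction possible.
mutual
  searchDist : ∀ {n} (G : Graph n) (u v : Fin n) (k f : ℕ) →
               _ ≡ search (λ j → walkB G j u v) k f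

  dist≡search : ∀ {n} (G : Graph n) u v → dist G u v ≡ search (λ j → walkB G j u v) 0 n
  dist≡search {suc m} G u v with walkB G 0 u v
  ... | true  = refl
  -- Turning all arguments into variables lets unification determine the omitted left-hand side.
  ... | false with suc m | G | u | v | 1
  ... | _ | G′ | u′ | v′ | k = searchDist G′ u′ v′ k m

  searchDist G u v k zero    = refl
  searchDist G u v k (suc f) with walkB G k u v
  ... | true  = refl
  ... | false = searchDist G u v (suc k) f

search≤ : ∀ p k f {j} → k ≤ j → p j ≡ true → search p k f ≤ j
search≤ p k zero    k≤j pj = k≤j
search≤ p k (suc f) {j} k≤j pj with p k in eq
... | true  = k≤j
... | false with m≤n⇒m<n∨m≡n k≤j
...   | inj₁ k<j  = search≤ p (suc k) f k<j pj
...   | inj₂ refl = contradiction (trans (sym pj) eq) λ ()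

-- A search that fails returns k + f, where p is never tested; the strict bound excludes this
-- default.
search-finds : ∀ p k f → search p k f < k + f → p (search p k f) ≡ true
search-finds p k zero    lt = contradiction (subst (k <_) (+-identityʳ k) lt) (n≮n k)
search-finds p k (suc f) lt with p k in eq
... | true  = eq
... | false = search-finds p (suc k) f (subst (search p (suc k) f <_) (+-suc k f) lt)

≤max : ∀ {n} (f : Fin n → ℕ) x → f x ≤ foldr _⊔_ 0 (map f (allFin n))
≤max {n} f x = go (∈-allFin x)
  where
  go : ∀ {xs} → x ∈ xs → f x ≤ foldr _⊔_ 0 (map f xs)
  go (here refl)              = m≤m⊔n _ _
  go {y ∷ xs} (there x∈xs)    = ≤-trans (go x∈xs) (m≤n⊔m (f y) _)

max≤ : ∀ {n} (f : Fin n → ℕ) {c} → (∀ x → f x ≤ c) → foldr _⊔_ 0 (map f (allFin n)) ≤ c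
max≤ {n} f {c} f≤c = go (allFin n)
  where
  go : ∀ xs → foldr _⊔_ 0 (map f xs) ≤ c
  go []       = z≤n
  go (x ∷ xs) = ⊔-lub (f≤c x) (go xs)

-- Walks behind the Boolean distance

module Walks {n : ℕ} (G : Graph n) where

  data Walk : ℕ → Fin n → Fin n → Set where
    []  : ∀ {u} → Walk 0 u u
    _∷_ : ∀ {k u v w} → Adj G u v → Walk k v w → Walk (suc k) u w

  infixr 5 _∷_ _++ʷ_

  _++ʷ_ : ∀ {k l u v w} → Walk k u v → Walk l v w → Walk (k + l) u w
  []      ++ʷ q = q
  (a ∷ p) ++ʷ q = a ∷ (p ++ʷ q)

  module _ (G-sym : ∀ u v → G u v ≡ G v u) where

    Adj-sym : ∀ {u v} → Adj G u v → Adj G v u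
    Adj-sym {u} {v} a = trans (G-sym v u) a

    reverseʷ : ∀ {k u v} → Walk k u v → Walk k v u
    reverseʷ []                = []
    reverseʷ {suc k} {u} {v} (a ∷ p) = subst (λ l → Walk l v u) (+-comm k 1) (reverseʷ p ++ʷ Adj-sym a ∷ [])

  fromB : ∀ k {u v} → walkB G k u v ≡ true → Walk k u v
  fromB zero    {u} {v} eq with u ≟ v
  ... | yes refl = []
  fromB (suc k) {u} {v} eq with Any.satisfied (any⁻ _ (allFin n) (Equivalence.from T-≡ eq))
  ... | w , t with G u w in uw | walkB G k w v in rest
  ...   | true | true = uw ∷ fromB k rest

  toB : ∀ {k u v} → Walk k u v → walkB G k u v ≡ true
  toB {u = u} []            = dec-true (u ≟ u) refl
  toB {v = v} (_∷_ {k} {u} {w} a p) = Equivalence.to T-≡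
    (any⁺ _ (lose (∈-allFin w) (Equivalence.from T-≡ (cong₂ _∧_ a (toB p)))))

  dist≤ : ∀ {k u v} → Walk k u v → dist G u v ≤ k
  dist≤ {k} {u} {v} p =
    subst (_≤ k) (sym (dist≡search G u v)) (search≤ (λ j → walkB G j u v) 0 n z≤n (toB p))

  shortest : ∀ u v → dist G u v < n → Walk (dist G u v) u v
  shortest u v lt = fromB _ (subst (λ d → walkB G d u v ≡ true) (sym (dist≡search G u v))
    (search-finds _ 0 n (subst (_< n) (dist≡search G u v) lt)))

  dist-self : ∀ u → dist G u u ≡ 0
  dist-self u = n≤0⇒n≡0 (dist≤ [])

  dist≤ecc : ∀ u v → dist G u v ≤ ecc G u
  dist≤ecc u = ≤max (dist G u)

  ecc≤ : ∀ u {c} → (∀ v → dist G u v ≤ c) → ecc G u ≤ c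
  ecc≤ u = max≤ (dist G u)

  dist≢0 : ∀ {u v} → u ≢ v → dist G u v < n → 0 < dist G u v
  dist≢0 {u} {v} u≢v lt with dist G u v | shortest u v lt
  ... | zero  | [] = contradiction refl u≢v
  ... | suc _ | _  = z<s

-- The height must drop towards the parent, but not by exactly one: this leaves room for keeping the
-- heights of T after the move.
Parental : ∀ {n} → Graph n → (Fin n → ℕ) → (Fin n → Fin n) → Set
Parental G h par = ∀ {x y} → Adj G x y → (par x ≡ y × h y < h x) ⊎ (par y ≡ x × h x < h y)

-- Along a cycle the height can never drop after a rise, since the only lower neighbour of a
-- vertex is its parent; so both cycle neighbours of the start would be its parent.
module ParentalAcyclic {n : ℕ} {G : Graph n} {h : Fin n → ℕ} {par : Fin n → Fin n}
                       (parental : Parental G h par) where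

  -- A step down from b would lead back to its parent a, which distinctness forbids. So all further
  -- steps rise, and x is reached from its parent.
  rising : ∀ {a b x} zs → par b ≡ a → Unique (a ∷ b ∷ zs) → All (x ≢_) (a ∷ b ∷ zs) →
           Linked (Adj G) (b ∷ zs ++ [ x ]) → par x ∈ (b ∷ zs) × h b < h x
  rising [] pb uniq (x≢a ∷ _) (bx ∷ _) with parental bx
  ... | inj₁ (pb′ , _)   = contradiction (trans (sym pb′) pb) x≢a
  ... | inj₂ (px , b<x)  = here px , b<x
  rising (c ∷ zs) pb ((_ ∷ a≢c ∷ _) ∷ uniq) (_ ∷ x∉) (bc ∷ link) with parental bc
  ... | inj₁ (pb′ , _)   = contradiction (trans (sym pb) pb′) a≢c
  ... | inj₂ (pc , b<c)  with rising zs pc uniq x∉ link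
  ...   | px∈ , c<x = there px∈ , <-trans b<c c<x

  -- Either every step falls, or `rising` takes over at the first rise.
  falling : ∀ {b x} zs → Unique (b ∷ zs) → All (x ≢_) (b ∷ zs) →
            Linked (Adj G) (b ∷ zs ++ [ x ]) → par x ∈ (b ∷ zs) ⊎ h x < h b
  falling [] uniq x∉ (bx ∷ _) with parental bx
  ... | inj₁ (_ , x<b) = inj₂ x<b
  ... | inj₂ (px , _)  = inj₁ (here px)
  falling (c ∷ zs) uniq′@(_ ∷ uniq) x∉′@(_ ∷ x∉) (bc ∷ link) with parental bc
  ... | inj₂ (pc , _)   = inj₁ (there (proj₁ (rising zs pc uniq′ x∉′ link)))
  ... | inj₁ (_ , c<b)  with falling zs uniq x∉ link
  ...   | inj₁ px∈ = inj₁ (there px∈)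
  ...   | inj₂ x<c = inj₂ (<-trans x<c c<b)

  acyclic : Acyclic G
  acyclic (x , b ∷ c ∷ zs , _ , (x∉@(_ ∷ x≢c ∷ _) ∷ uniq@(b∉ ∷ uniq′)) , (xb ∷ link@(bc ∷ link′)))
    -- If b is lowest or highest among x, b, c, its position decides through `par`: as highest it
    -- has both x and c as parent, as lowest it is the parent of x while `rising` finds that parent
    -- among the later vertices. If both steps rise, h x < h x; if both fall, `falling` decides.
    with parental xb | parental bc
  ... | inj₂ (pb , x<b) | inj₁ (pb′ , _)  = x≢c (trans (sym pb) pb′)
  ... | inj₂ (pb , x<b) | inj₂ (pc , b<c) =
    <-irrefl refl (<-trans x<b (<-trans b<c (proj₂ (rising zs pc uniq x∉ link′))))
  ... | inj₁ (px , b<x) | inj₂ (pc , _)   =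
    All.lookup b∉ (proj₁ (rising zs pc uniq x∉ link′)) (sym px)
  ... | inj₁ (px , b<x) | inj₁ (_ , c<b) with falling zs uniq′ (All.tail x∉) link′
  ...   | inj₁ px∈ = All.lookup b∉ px∈ (sym px)
  ...   | inj₂ x<c = <-asym x<c (<-trans c<b b<x)
  acyclic (_ , [] , () , _)
  acyclic (_ , _ ∷ [] , s≤s () , _)

-- Closing detours to cycles

module Acyclicity {n : ℕ} (G : Graph n) (G-sym : ∀ u v → G u v ≡ G v u) (acyclic : Acyclic G) where

  open DecMembership (_≟_ {n}) using (_∈?_)

  AdjAvoiding : Fin n → Fin n → Fin n → Set
  AdjAvoiding x y z = Adj G y z × x ≢ y × x ≢ z

  -- A simple path in G - x, indexed by its vertex list, from which the components of a `Cycle`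
  -- through x are read off.
  data SimplePath (x t : Fin n) : Fin n → List (Fin n) → Set where
    end  : x ≢ t → SimplePath x t t [ t ]
    step : ∀ {y z zs} → x ≢ y → Adj G y z → y ∉ zs → SimplePath x t z zs → SimplePath x t y (y ∷ zs)

  suffix : ∀ {x t y z zs} → y ∈ zs → SimplePath x t z zs → ∃ (SimplePath x t y)
  suffix (here refl) p@(end _)        = _ , p
  suffix (here refl) p@(step _ _ _ _) = _ , p
  suffix (there y∈)  (step _ _ _ p)   = suffix y∈ p

  -- Loop erasure: if y recurs on the simplified rest, only the part from that recurrence on is
  -- kept.
  simplify : ∀ {x y t} → x ≢ t → Star (AdjAvoiding x) y t → ∃ (SimplePath x t y)
  simplify x≢t ε⋆ = _ , end x≢t
  simplify {y = y} x≢t ((yz , x≢y , _) ◅ p) with simplify x≢t p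
  ... | zs , q with y ∈? zs
  ...   | yes y∈ = suffix y∈ q
  ...   | no  y∉ = _ , step x≢y yz y∉ q

  avoids : ∀ {x t y zs} → SimplePath x t y zs → All (x ≢_) zs
  avoids (end x≢t)        = x≢t ∷ []
  avoids (step x≢y _ _ p) = x≢y ∷ avoids p

  unique : ∀ {x t y zs} → SimplePath x t y zs → Unique zs
  unique (end _)          = [] ∷ []
  unique (step _ _ y∉ p)  = ¬Any⇒All¬ _ y∉ ∷ unique p

  linked : ∀ {x t w y zs} → Adj G w y → Adj G t x → SimplePath x t y zs →
           Linked (Adj G) (w ∷ zs ++ [ x ])
  linked wy tx (end _)         = wy ∷ tx ∷ [-]
  linked wy tx (step _ yz _ p) = wy ∷ linked yz tx p

  long : ∀ {x t y zs} → y ≢ t → SimplePath x t y zs → 2 ≤ length zs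
  long y≢t (end _)                     = contradiction refl y≢t
  long y≢t (step _ _ _ (end _))        = s≤s (s≤s z≤n)
  long y≢t (step _ _ _ (step _ _ _ _)) = s≤s (s≤s z≤n)

  -- Otherwise a path in G - x between two neighbours of x would close to a cycle through x.
  neighbours-joined⇒≡ : ∀ {x y t} → Adj G x y → Adj G x t → x ≢ t →
                        Star (AdjAvoiding x) y t → y ≡ t
  neighbours-joined⇒≡ {x} {y} {t} xy xt x≢t p with y ≟ t
  ... | yes y≡t = y≡t
  ... | no  y≢t with simplify x≢t p
  ...   | zs , q = ⊥-elim (acyclic
          (x , zs , long y≢t q , avoids q ∷ unique q , linked xy (trans (G-sym t x) xt) q))

-- Heights and parents in a rooted tree

module Rooted {n : ℕ} (G : Graph n) (simple : IsSimple G) (acyclic : Acyclic G)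
              (dist<n : ∀ u v → dist G u v < n) (r : Fin n) where

  open Walks G
  open Acyclicity G (proj₁ simple) acyclic

  h : Fin n → ℕ
  h x = dist G x r

  h≡0⇒r : ∀ {x} → h x ≡ 0 → x ≡ r
  h≡0⇒r {x} eq with dist G x r | shortest x r (dist<n x r)
  h≡0⇒r refl | zero | [] = refl

  h-adj : ∀ {x y} → Adj G x y → h x ≤ suc (h y)
  h-adj {y = y} xy = dist≤ (xy ∷ shortest y r (dist<n y r))

  lower : ∀ x → x ≢ r → ∃ λ y → Adj G x y × h x ≡ suc (h y)
  lower x x≢r with dist G x r in eq | shortest x r (dist<n x r)
  ... | zero  | [] = contradiction refl x≢r
  ... | suc k | _∷_ {v = y} xy p = y , xy ,
        ≤-antisym (subst (_≤ suc (h y)) eq (h-adj xy)) (s≤s (dist≤ p))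

  irrefl : ∀ {x y} → Adj G x y → x ≢ y
  irrefl {x} xx refl = contradiction (trans (sym xx) (proj₂ simple x)) λ ()

  -- All vertices after y are strictly lower than x, and y itself differs from x, so the descent
  -- never meets x. The height k of y drives the recursion.
  descend : ∀ x k y → h y ≡ k → x ≢ y → h y ≤ h x → Star (AdjAvoiding x) y r
  descend x zero    y eq x≢y le rewrite h≡0⇒r eq = ε⋆
  descend x (suc k) y eq x≢y le with y ≟ r
  ... | yes refl = ε⋆
  ... | no  y≢r  with lower y y≢r
  ...   | z , yz , hy≡ = (yz , x≢y , x≢z) ◅ descend x k z (suc-injective (trans (sym hy≡) eq)) x≢z (<⇒≤ z<x)
    where
    z<x : h z < h x
    z<x = subst (_≤ h x) hy≡ le
    x≢z : x ≢ z
    x≢z refl = <-irrefl refl z<x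

  -- Both neighbours descend to r in G - x, so they are joined there.
  lower-unique : ∀ {x y z} → Adj G x y → Adj G x z → h y ≤ h x → h z ≤ h x → y ≡ z
  lower-unique {x} {y} {z} xy xz y≤x z≤x = neighbours-joined⇒≡ xy xz (irrefl xz)
    (descend x _ y refl (irrefl xy) y≤x ◅◅
     reverse (λ (a , p , q) → trans (proj₁ simple _ _) a , q , p) (descend x _ z refl (irrefl xz) z≤x))

  -- Taking r as its own parent means that a vertex whose parent is not r cannot be r, which
  -- `below≢r` uses.
  par : Fin n → Fin n
  par x with x ≟ r
  ... | yes _   = r
  ... | no  x≢r = proj₁ (lower x x≢r)

  par-r : par r ≡ r
  par-r with r ≟ r
  ... | yes _  = refl
  ... | no r≢r = contradiction refl r≢r

  par-spec : ∀ {x} → x ≢ r → Adj G x (par x) × h x ≡ suc (h (par x))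
  par-spec {x} x≢r with x ≟ r
  ... | yes x≡r = contradiction x≡r x≢r
  ... | no  x≢r = proj₂ (lower x x≢r)

  -- By `lower-unique`, y is the lower neighbour chosen by `par`. As the bound is not strict, this
  -- also excludes edges within one level.
  toParent : ∀ {x y} → Adj G x y → h y ≤ h x → par x ≡ y × h x ≡ suc (h y)
  toParent {x} {y} xy y≤x with x ≟ r
  ... | yes refl = contradiction
        (sym (h≡0⇒r (n≤0⇒n≡0 (subst (h y ≤_) (dist-self r) y≤x)))) (irrefl xy)
  ... | no x≢r with lower x x≢r
  ...   | z , xz , hx≡ with lower-unique xz xy (subst (h z ≤_) (sym hx≡) (n≤1+n _)) y≤x
  ...     | refl = refl , hx≡

  edge : ∀ {x y} → Adj G x y → (par x ≡ y × h x ≡ suc (h y)) ⊎ (par y ≡ x × h y ≡ suc (h x))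
  edge {x} {y} xy with ≤-total (h y) (h x)
  ... | inj₁ y≤x = inj₁ (toParent xy y≤x)
  ... | inj₂ x≤y = inj₂ (toParent (trans (proj₁ simple y x) xy) x≤y)

-- Moving the branches

δ : ∀ {n} → Fin n → Fin n → ℕ
δ p y = if does (y ≟ p) then 1 else 0

Σ-δ+ : ∀ {n} (p : Fin n) (f : Fin n → ℕ) → Σ⟨ (λ y → δ p y + f y) ⟩ ≡ suc Σ⟨ f ⟩
Σ-δ+ p f = trans (Σ-+ (δ p) f) (cong (_+ Σ⟨ f ⟩) (Σ-single p 1))

Σ-δ+δ : ∀ {n} (p q : Fin n) → Σ⟨ (λ y → δ p y + δ q y) ⟩ ≡ 2
Σ-δ+δ p q = trans (Σ-δ+ p (δ q)) (cong suc (Σ-single q 1))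

module _ {n : ℕ} (G : Graph n) where

  deg≡1 : ∀ {x p} → Adj G x p → (∀ {y} → Adj G x y → y ≡ p) → deg G x ≡ 1
  deg≡1 {x} {p} xp only = trans (Σ-cong pointwise) (Σ-single p 1)
    where
    pointwise : ∀ y → (if G x y then 1 else 0) ≡ δ p y
    pointwise y with y ≟ p
    ... | yes refl rewrite xp = refl
    ... | no  y≢p with G x y in xy
    ...   | true  = contradiction (only xy) y≢p
    ...   | false = refl

  deg≡2 : ∀ {x p q} → p ≢ q → Adj G x p → Adj G x q →
          (∀ {y} → Adj G x y → y ≡ p ⊎ y ≡ q) → deg G x ≡ 2
  deg≡2 {x} {p} {q} p≢q xp xq only = trans (Σ-cong pointwise) (Σ-δ+δ p q)
    where
    pointwise : ∀ y → (if G x y then 1 else 0) ≡ δ p y + δ q y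
    pointwise y with y ≟ p | y ≟ q
    ... | yes refl | yes refl = contradiction refl p≢q
    ... | yes refl | no _     rewrite xp = refl
    ... | no _     | yes refl rewrite xq = refl
    ... | no y≢p   | no y≢q   with G x y in xy
    ...   | false = refl
    ...   | true  with only xy
    ...     | inj₁ y≡p = contradiction y≡p y≢p
    ...     | inj₂ y≡q = contradiction y≡q y≢q

  2≤deg : ∀ {x p q} → p ≢ q → Adj G x p → Adj G x q → 2 ≤ deg G x
  2≤deg {x} {p} {q} p≢q xp xq = subst (_≤ deg G x) (Σ-δ+δ p q) (Σ-mono pointwise)
    where
    pointwise : ∀ y → δ p y + δ q y ≤ (if G x y then 1 else 0)
    pointwise y with y ≟ p | y ≟ q
    ... | yes refl | yes refl = contradiction refl p≢q
    ... | yes refl | no _     rewrite xp = ≤-refl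
    ... | no _     | yes refl rewrite xq = ≤-refl
    ... | no _     | no _     = z≤n

  1≤deg : ∀ {x p} → Adj G x p → 1 ≤ deg G x
  1≤deg {x} {p} xp = subst (_≤ deg G x) (cong (if_then 1 else 0) xp)
    (term≤Σ (λ y → if G x y then 1 else 0) p)

  Mprod≡deg : ∀ {x p} → Adj G x p → (∀ {y} → Adj G x y → y ≢ p → deg G y ≡ 1) →
              Mprod G x ≡ deg G p
  Mprod≡deg {x} {p} xp leaf = trans (Π-cong pointwise) (Π-single p (deg G p))
    where
    pointwise : ∀ y → (if G x y then deg G y else 1) ≡ (if does (y ≟ p) then deg G p else 1)
    pointwise y with y ≟ p
    ... | yes refl rewrite xp = refl
    ... | no  y≢p with G x y in xy
    ...   | true  = leaf xy y≢p
    ...   | false = refl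

-- Compares total loss with total gain, for j = K - 1 - k and g = b - 1 - ε. For ε = 0 it reduces to
-- b ≤ Q. For ε = 1 the terms k g cancel, and 2 k + b j ≤ Q k + 2 Q j follows from 2 ≤ Q and b ≤ 1 +
-- Q ≤ 2 Q.
balance : ∀ b k j g {Q ε} → 2 ≤ Q → b ≤ suc Q → (ε ≡ 0 × b ≤ Q) ⊎ ε ≡ 1 →
          b * j + (ε + g) * k + ε * k ≤ Q * (ε * k + suc ε * j) + k * g
balance b k j g {Q} _ _ (inj₁ (refl , b≤Q)) = begin
  b * j + g * k + 0        ≡⟨ +-identityʳ _ ⟩
  b * j + g * k            ≤⟨ +-mono-≤ (*-monoˡ-≤ j b≤Q) (≤-reflexive (*-comm g k)) ⟩
  Q * j + k * g            ≡⟨ cong (λ s → Q * s + k * g) (+-identityʳ j) ⟨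
  Q * (j + 0) + k * g      ∎
  where open ≤-Reasoning
balance b k j g {Q} 2≤Q b≤1+Q (inj₂ refl) = begin
  b * j + (1 + g) * k + 1 * k    ≡⟨ regroup b j g k ⟩
  2 * k + b * j + k * g          ≤⟨ +-monoˡ-≤ (k * g) (+-mono-≤ (*-monoˡ-≤ k 2≤Q) (*-monoˡ-≤ j b≤2Q)) ⟩
  Q * k + (Q + Q) * j + k * g    ≡⟨ refactor Q k j g ⟩
  Q * (1 * k + 2 * j) + k * g    ∎
  where
  open ≤-Reasoning
  b≤2Q : b ≤ Q + Q
  b≤2Q = ≤-trans b≤1+Q (+-monoˡ-≤ Q (≤-trans (s≤s z≤n) 2≤Q))
  regroup : ∀ b j g k → b * j + (1 + g) * k + 1 * k ≡ 2 * k + b * j + k * g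
  regroup = solve-∀
  refactor : ∀ Q k j g → Q * k + (Q + Q) * j + k * g ≡ Q * (1 * k + 2 * j) + k * g
  refactor = solve-∀

-- The tree T is hung from v_D; h is the distance to v_D, W marks w₁, …, w_k, and D = 5 + d.
record Configuration {n : ℕ} (T T′ : Graph n) : Set where
  field
    d           : ℕ
    T-sym       : ∀ u v → T u v ≡ T v u
    T-irrefl    : ∀ u → T u u ≡ false
    D<n         : 5 + d < n
    dist≤D      : ∀ u v → dist T u v ≤ 5 + d
    mate        : Fin n → Fin n
    mate-adj    : ∀ x → Adj T x (mate x)
    mate-mate   : ∀ x → mate (mate x) ≡ x
    r           : Fin n
    h           : Fin n → ℕ
    par         : Fin n → Fin n
    h≤dist      : ∀ x → h x ≤ dist T x r
    h-r         : h r ≡ 0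
    edge        : ∀ {x y} → Adj T x y →
                  (par x ≡ y × h x ≡ suc (h y)) ⊎ (par y ≡ x × h y ≡ suc (h x))
    par-r       : par r ≡ r
    par-spec    : ∀ {x} → x ≢ r → Adj T x (par x) × h x ≡ suc (h (par x))
    v0 v1 v2 v3 v4 v5 : Fin n
    par-v0      : par v0 ≡ v1
    par-v1      : par v1 ≡ v2
    par-v2      : par v2 ≡ v3
    adj34       : Adj T v3 v4
    adj45       : Adj T v4 v5
    v2≢v4       : v2 ≢ v4
    v3≢v5       : v3 ≢ v5
    h-v2        : h v2 ≡ 3 + d
    W           : Fin n → Bool
    W-elim      : ∀ {x} → W x ≡ true → Adj T v2 x × x ≢ v3 × deg T x ≡ 2
    W-intro     : ∀ {x} → Adj T v2 x → x ≢ v3 → deg T x ≡ 2 → W x ≡ true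
    T′-sym      : ∀ u v → T′ u v ≡ T′ v u
    T′-unmoved  : ∀ {x y} → W x ≡ false → W y ≡ false → T′ x y ≡ T x y
    T′-moved    : ∀ {x} → W x ≡ true → ∀ y →
                  T′ x y ≡ (does (y ≟ v3) ∨ (T x y ∧ not (does (y ≟ v2))))

-- The branches at v_2

module Comparison {n : ℕ} {T T′ : Graph n} (conf : Configuration T T′) where

  open Configuration conf
  open Walks T
  open Walks T′ using () renaming
    (Walk to Walk′; [] to []′; _∷_ to _∷′_; _++ʷ_ to _++′_; dist≤ to dist′≤; ecc≤ to ecc′≤; toB to toB′;
     dist≤ecc to dist′≤ecc′; dist≢0 to dist′≢0)

  symm : ∀ {x y} → Adj T x y → Adj T y x
  symm {x} {y} xy = trans (T-sym y x) xy

  symm′ : ∀ {x y} → Adj T′ x y → Adj T′ y x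
  symm′ {x} {y} xy = trans (T′-sym y x) xy

  rev′ : ∀ {k x y} → Walk′ k x y → Walk′ k y x
  rev′ = Walks.reverseʷ T′ T′-sym

  adj≢ : ∀ {x y} → Adj T x y → x ≢ y
  adj≢ {x} xx refl = contradiction (trans (sym xx) (T-irrefl x)) λ ()

  h≢ : ∀ {x y i j} → h x ≡ i → h y ≡ j → i ≢ j → x ≢ y
  h≢ hx hy i≢j refl = i≢j (trans (sym hx) hy)

  h≤D : ∀ x → h x ≤ 5 + d
  h≤D x = ≤-trans (h≤dist x) (dist≤D x r)

  v2≢r : v2 ≢ r
  v2≢r = h≢ h-v2 h-r λ ()

  adj23 : Adj T v2 v3
  adj23 = subst (Adj T v2) par-v2 (proj₁ (par-spec v2≢r))

  h-v3 : h v3 ≡ 2 + d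
  h-v3 = suc-injective (trans (sym (trans (proj₂ (par-spec v2≢r)) (cong (λ z → suc (h z)) par-v2))) h-v2)

  v2≢v3 : v2 ≢ v3
  v2≢v3 = adj≢ adj23

  mate-≡ : ∀ {x y} → mate x ≡ y → mate y ≡ x
  mate-≡ {x} refl = mate-mate x

  mate-leaf : ∀ {x y} → (∀ {z} → Adj T x z → z ≡ y) → mate x ≡ y
  mate-leaf {x} only = only (mate-adj x)

  below≢r : ∀ {x y} → par x ≡ y → y ≢ r → x ≢ r
  below≢r px y≢r refl = y≢r (trans (sym px) par-r)

  below-spec : ∀ {x y} → par x ≡ y → y ≢ r → Adj T x y × h x ≡ suc (h y)
  below-spec refl y≢r = par-spec (below≢r refl y≢r)

  module Child {x} (px : par x ≡ v2) where

    x≢r : x ≢ r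
    x≢r = below≢r px v2≢r

    adj2 : Adj T x v2
    adj2 = proj₁ (below-spec px v2≢r)

    height : h x ≡ 4 + d
    height = trans (proj₂ (below-spec px v2≢r)) (cong suc h-v2)

    ≢v2 : x ≢ v2
    ≢v2 = h≢ height h-v2 λ ()

    ≢v3 : x ≢ v3
    ≢v3 = h≢ height h-v3 λ ()

    T3≡false : T v3 x ≡ false
    T3≡false with T v3 x in eq
    ... | false = refl
    ... | true with edge eq
    ...   | inj₁ (_ , e) = contradiction (trans (sym h-v3) (trans e (cong suc height))) λ ()
    ...   | inj₂ (p , _) = contradiction (trans (sym px) p) v2≢v3

  module Grandchild {x w} (px : par x ≡ w) (pw : par w ≡ v2) where

    open Child pw using () renaming (x≢r to w≢r)

    adj : Adj T x w
    adj = proj₁ (below-spec px w≢r)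

    height : h x ≡ 5 + d
    height = trans (proj₂ (below-spec px w≢r)) (cong suc (Child.height pw))

    only : ∀ {y} → Adj T x y → y ≡ w
    only xy with edge xy
    ... | inj₁ (px′ , _) = trans (sym px′) px
    -- A child of x would have height 6 + d, above the maximal distance.
    ... | inj₂ (_ , hy)  = contradiction (subst (_≤ 5 + d) (trans hy (cong suc height)) (h≤D _)) (n≮n _)

    leaf : deg T x ≡ 1
    leaf = deg≡1 T adj only

    -- The leaf x can only be matched to w. Hence each child of v_2 has at most one child, namely
    -- its mate.
    mate-w : mate w ≡ x
    mate-w = mate-≡ (mate-leaf only)

    ≢v2 : x ≢ v2
    ≢v2 = h≢ height h-v2 λ ()

    ≢v3 : x ≢ v3
    ≢v3 = h≢ height h-v3 λ ()

    par≢v2 : par x ≢ v2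
    par≢v2 e = Child.≢v2 pw (trans (sym px) e)

  -- The leaf children of v_2, recognised by their mate: a child of v_2 matched upwards is
  -- childless, since any child would be its mate.
  U : Fin n → Bool
  U x = does (par x ≟ v2) ∧ does (mate x ≟ v2)

  -- Matching on kind y evaluates the five Booleans at y simultaneously.
  data Kind (y : Fin n) : (is-v2 is-v3 is-W is-U adj-v2 : Bool) → Set where
    kind-v2    : y ≡ v2 → Kind y true false false false false
    kind-v3    : y ≡ v3 → Kind y false true false false true
    kind-W     : par y ≡ v2 → par (mate y) ≡ y → deg T y ≡ 2 → Kind y false false true false true
    kind-U     : par y ≡ v2 → mate y ≡ v2 → deg T y ≡ 1 → Kind y false false false true true
    kind-other : y ≢ v2 → y ≢ v3 → par y ≢ v2 → Kind y false false false false false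

  recast : ∀ {y a b c d e a′ b′ c′ d′ e′} → a ≡ a′ → b ≡ b′ → c ≡ c′ → d ≡ d′ → e ≡ e′ →
           Kind y a′ b′ c′ d′ e′ → Kind y a b c d e
  recast refl refl refl refl refl κ = κ

  adj-v2 : ∀ {x} → Adj T v2 x → x ≢ v3 → par x ≡ v2
  adj-v2 a x≢v3 with edge a
  ... | inj₁ (p , _) = contradiction (trans (sym p) par-v2) x≢v3
  ... | inj₂ (p , _) = p

  W-false : ∀ {x} → (par x ≡ v2 → deg T x ≢ 2) → W x ≡ false
  W-false {x} no2 with W x in eq
  ... | false = refl
  ... | true with W-elim eq
  ...   | a , x≢v3 , d2 = contradiction d2 (no2 (adj-v2 a x≢v3))

  T2-false : ∀ {x} → x ≢ v3 → par x ≢ v2 → T v2 x ≡ false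
  T2-false {x} x≢v3 px with T v2 x in eq
  ... | false = refl
  ... | true  = contradiction (adj-v2 eq x≢v3) px

  child-cases : ∀ {x} → par x ≡ v2 → (mate x ≡ v2) ⊎ (par (mate x) ≡ x)
  child-cases {x} px with edge (mate-adj x)
  ... | inj₁ (p , _) = inj₁ (trans (sym p) px)
  ... | inj₂ (p , _) = inj₂ p

  childless : ∀ {x y} → par x ≡ v2 → mate x ≡ v2 → Adj T x y → y ≡ v2
  childless px mx xy with edge xy
  ... | inj₁ (p , _) = trans (sym p) px
  ... | inj₂ (p , _) = trans (sym (Grandchild.mate-w p px)) mx

  only-child : ∀ {x y} → par x ≡ v2 → Adj T x y → y ≡ v2 ⊎ y ≡ mate x
  only-child px xy with edge xy
  ... | inj₁ (p , _) = inj₁ (trans (sym p) px)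
  ... | inj₂ (p , _) = inj₂ (sym (Grandchild.mate-w p px))

  deg-parent : ∀ {x w} → par x ≡ w → par w ≡ v2 → deg T w ≡ 2
  deg-parent px pw = deg≡2 T (λ e → GC.≢v2 (sym e)) (Child.adj2 pw) (symm GC.adj)
    (λ a → Sum.map₂ (λ e → trans e GC.mate-w) (only-child pw a))
    where module GC = Grandchild px pw

  W-parent : ∀ {x w} → par x ≡ w → par w ≡ v2 → W w ≡ true
  W-parent px pw = W-intro (symm (Child.adj2 pw)) (Child.≢v3 pw) (deg-parent px pw)

  kind : ∀ y → Kind y (does (y ≟ v2)) (does (y ≟ v3)) (W y) (U y) (T v2 y)
  kind y with par y ≟ v2
  ... | yes py with child-cases py
  ...   | inj₁ my = recast (dec-false (y ≟ v2) C.≢v2) (dec-false (y ≟ v3) C.≢v3)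
            (W-false λ _ e → contradiction (trans (sym e) d1) λ ())
            (dec-true (mate y ≟ v2) my) (symm C.adj2) (kind-U py my d1)
    where
    module C = Child py
    d1 : deg T y ≡ 1
    d1 = deg≡1 T C.adj2 (childless py my)
  ...   | inj₂ pm = recast (dec-false (y ≟ v2) C.≢v2) (dec-false (y ≟ v3) C.≢v3)
            (W-parent pm py)
            (dec-false (mate y ≟ v2) (Grandchild.≢v2 pm py)) (symm C.adj2)
            (kind-W py pm (deg-parent pm py))
    where module C = Child py
  kind y | no py with y ≟ v2 | y ≟ v3
  ...   | yes refl | yes e    = contradiction e v2≢v3
  ...   | yes refl | no  _    = recast refl refl (W-false λ e → contradiction e py) refl
                                  (T-irrefl y) (kind-v2 refl)
  ...   | no _     | yes refl = recast refl refl (W-false λ e → contradiction e py) refl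
                                  adj23 (kind-v3 refl)
  ...   | no y≢v2  | no y≢v3  = recast refl refl (W-false λ e → contradiction e py) refl
                                  (T2-false y≢v3 py) (kind-other y≢v2 y≢v3 py)

  W⇒ : ∀ {x} → W x ≡ true → par x ≡ v2 × par (mate x) ≡ x × deg T x ≡ 2
  W⇒ {x} wx with does (x ≟ v2) | does (x ≟ v3) | W x | U x | T v2 x | kind x
  ... | _ | _ | _ | _ | _ | kind-W px pm d2 = px , pm , d2

  W-v2 : W v2 ≡ false
  W-v2 = W-false λ p → contradiction (trans (sym par-v2) p) (λ e → v2≢v3 (sym e))

  W-v3 : W v3 ≡ false
  W-v3 = W-false λ p → contradiction refl (Child.≢v3 p)

  par≢v2⇒¬W : ∀ {x} → par x ≢ v2 → W x ≡ false
  par≢v2⇒¬W px = W-false λ p → contradiction p px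

  U⇒ : ∀ {x} → U x ≡ true → par x ≡ v2 × mate x ≡ v2
  U⇒ {x} ux with does (x ≟ v2) | does (x ≟ v3) | W x | U x | T v2 x | kind x
  ... | _ | _ | _ | _ | _ | kind-U px mx _ = px , mx

  T′-v2W : ∀ {x} → W x ≡ true → T′ v2 x ≡ false
  T′-v2W {x} wx = begin
    T′ v2 x  ≡⟨ T′-sym v2 x ⟩
    T′ x v2  ≡⟨ T′-moved wx v2 ⟩
    does (v2 ≟ v3) ∨ (T x v2 ∧ not (does (v2 ≟ v2)))
      ≡⟨ cong₂ (λ p q → p ∨ (T x v2 ∧ not q)) (dec-false (v2 ≟ v3) v2≢v3) (dec-true (v2 ≟ v2) refl) ⟩
    T x v2 ∧ false  ≡⟨ ∧-zeroʳ (T x v2) ⟩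
    false ∎
    where open ≡-Reasoning

  T′-v3W : ∀ {x} → W x ≡ true → Adj T′ v3 x
  T′-v3W {x} wx = symm′ (trans (T′-moved wx v3)
    (cong (_∨ (T x v3 ∧ not (does (v3 ≟ v2)))) (dec-true (v3 ≟ v3) refl)))

  T′-away : ∀ {x y} → W x ≡ true → y ≢ v2 → y ≢ v3 → T′ x y ≡ T x y
  T′-away {x} {y} wx y≢v2 y≢v3 = trans (T′-moved wx y)
    (trans (cong₂ (λ p q → p ∨ (T x y ∧ not q)) (dec-false (y ≟ v3) y≢v3) (dec-false (y ≟ v2) y≢v2))
           (∧-identityʳ (T x y)))

  T′-row : ∀ {x} → W x ≡ false → x ≢ v2 → x ≢ v3 → ∀ y → T′ x y ≡ T x y
  T′-row {x} wx x≢v2 x≢v3 y with W y in wy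
  ... | false = T′-unmoved wx wy
  ... | true  = trans (T′-sym x y) (trans (T′-away wy x≢v2 x≢v3) (T-sym y x))

  -- Degrees and degree products before and after the move

  b k ε : ℕ
  b = deg T v3
  k = Σ⟨ (λ y → if W y then 1 else 0) ⟩
  ε = Σ⟨ (λ y → if U y then 1 else 0) ⟩

  deg-v2 : deg T v2 ≡ suc (k + ε)
  deg-v2 = begin
    deg T v2  ≡⟨ Σ-cong pointwise ⟩
    Σ⟨ (λ y → δ v3 y + ((if W y then 1 else 0) + (if U y then 1 else 0))) ⟩
      ≡⟨ Σ-δ+ v3 (λ y → (if W y then 1 else 0) + (if U y then 1 else 0)) ⟩
    suc Σ⟨ (λ y → (if W y then 1 else 0) + (if U y then 1 else 0)) ⟩
      ≡⟨ cong suc (Σ-+ (λ y → if W y then 1 else 0) (λ y → if U y then 1 else 0)) ⟩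
    suc (k + ε) ∎
    where
    open ≡-Reasoning
    pointwise : ∀ y → (if T v2 y then 1 else 0)
                    ≡ δ v3 y + ((if W y then 1 else 0) + (if U y then 1 else 0))
    pointwise y with does (y ≟ v2) | does (y ≟ v3) | W y | U y | T v2 y | kind y
    ... | _ | _ | _ | _ | _ | kind-v2 _        = refl
    ... | _ | _ | _ | _ | _ | kind-v3 _        = refl
    ... | _ | _ | _ | _ | _ | kind-W _ _ _     = refl
    ... | _ | _ | _ | _ | _ | kind-U _ _ _     = refl
    ... | _ | _ | _ | _ | _ | kind-other _ _ _ = refl

  T′-v2 : ∀ y → T′ v2 y ≡ T v2 y ∧ not (W y)
  T′-v2 y with W y in wy
  ... | true  = trans (T′-v2W wy) (sym (∧-zeroʳ (T v2 y)))
  ... | false = trans (T′-unmoved W-v2 wy) (sym (∧-identityʳ (T v2 y)))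

  T′-v3 : ∀ y → T′ v3 y ≡ T v3 y ∨ W y
  T′-v3 y with W y in wy
  ... | true  = trans (T′-v3W wy) (sym (∨-zeroʳ (T v3 y)))
  ... | false = trans (T′-unmoved W-v3 wy) (sym (∨-identityʳ (T v3 y)))

  deg′-v2 : deg T′ v2 ≡ suc ε
  deg′-v2 = trans (Σ-cong pointwise) (Σ-δ+ v3 (λ y → if U y then 1 else 0))
    where
    pointwise : ∀ y → (if T′ v2 y then 1 else 0) ≡ δ v3 y + (if U y then 1 else 0)
    pointwise y rewrite T′-v2 y with does (y ≟ v2) | does (y ≟ v3) | W y | U y | T v2 y | kind y
    ... | _ | _ | _ | _ | _ | kind-v2 _        = refl
    ... | _ | _ | _ | _ | _ | kind-v3 _        = refl
    ... | _ | _ | _ | _ | _ | kind-W _ _ _     = refl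
    ... | _ | _ | _ | _ | _ | kind-U _ _ _     = refl
    ... | _ | _ | _ | _ | _ | kind-other _ _ _ = refl

  deg′-v3 : deg T′ v3 ≡ b + k
  deg′-v3 = trans (Σ-cong pointwise) (Σ-+ (λ y → if T v3 y then 1 else 0) (λ y → if W y then 1 else 0))
    where
    pointwise : ∀ y → (if T′ v3 y then 1 else 0) ≡ (if T v3 y then 1 else 0) + (if W y then 1 else 0)
    pointwise y rewrite T′-v3 y with W y in wy
    ... | true rewrite Child.T3≡false (proj₁ (W⇒ wy)) = refl
    ... | false with T v3 y
    ...   | true  = refl
    ...   | false = refl

  deg′-W : ∀ {x} → W x ≡ true → deg T′ x ≡ 2
  deg′-W {x} wx with W⇒ wx
  ... | px , pm , d2 = deg≡2 T′ (λ e → GC.≢v3 (sym e)) (symm′ (T′-v3W wx))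
          (trans (T′-away wx GC.≢v2 GC.≢v3) (mate-adj x)) only
    where
    module GC = Grandchild pm px
    only : ∀ {y} → Adj T′ x y → y ≡ v3 ⊎ y ≡ mate x
    only {y} xy with y ≟ v3 | y ≟ v2
    ... | yes e | _ = inj₁ e
    ... | no _  | yes refl = contradiction (trans (sym (symm′ xy)) (T′-v2W wx)) λ ()
    ... | no y≢v3 | no y≢v2 with only-child px (trans (sym (T′-away wx y≢v2 y≢v3)) xy)
    ...   | inj₁ e = contradiction e y≢v2
    ...   | inj₂ e = inj₂ e

  deg′-other : ∀ {x} → x ≢ v2 → x ≢ v3 → deg T′ x ≡ deg T x
  deg′-other {x} x≢v2 x≢v3 with W x in wx
  ... | true  = trans (deg′-W wx) (sym (proj₂ (proj₂ (W⇒ wx))))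
  ... | false = Σ-cong λ y → cong (if_then 1 else 0) (T′-row wx x≢v2 x≢v3 y)

  -- `Kf` collects the new neighbours of v_3. `Qf` leaves out v_2, the only neighbour of v_3 in T
  -- whose degree changes, so both products reappear in T′.
  Kf Qf : Fin n → ℕ
  Kf y = if W y then deg T y else 1
  Qf y = if does (y ≟ v2) then 1 else (if T v3 y then deg T y else 1)

  K Q : ℕ
  K = Π⟨ Kf ⟩
  Q = Π⟨ Qf ⟩

  M-v2 : Mprod T v2 ≡ b * K
  M-v2 = trans (Π-cong pointwise) (trans (Π-* at-v3 Kf) (cong (_* K) (Π-single v3 b)))
    where
    at-v3 : Fin n → ℕ
    at-v3 y = if does (y ≟ v3) then b else 1
    pointwise : ∀ y → (if T v2 y then deg T y else 1) ≡ at-v3 y * Kf y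
    pointwise y with does (y ≟ v2) | does (y ≟ v3) | W y | U y | T v2 y | kind y
    ... | _ | _ | _ | _ | _ | kind-v2 _        = refl
    ... | _ | _ | _ | _ | _ | kind-v3 refl     = sym (*-identityʳ b)
    ... | _ | _ | _ | _ | _ | kind-W _ _ _     = sym (+-identityʳ _)
    ... | _ | _ | _ | _ | _ | kind-U _ _ d1    = d1
    ... | _ | _ | _ | _ | _ | kind-other _ _ _ = refl

  adj23′ : Adj T′ v2 v3
  adj23′ = trans (T′-unmoved W-v2 W-v3) adj23

  M′-v2 : Mprod T′ v2 ≡ b + k
  M′-v2 = trans (Mprod≡deg T′ adj23′ leaf) deg′-v3
    where
    leaf : ∀ {y} → Adj T′ v2 y → y ≢ v3 → deg T′ y ≡ 1
    leaf {y} a y≢v3 with W y in wy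
    ... | true  = contradiction (trans (sym a) (T′-v2W wy)) λ ()
    ... | false with trans (sym (T′-unmoved W-v2 wy)) a
    ...   | a₀ with child-cases (adj-v2 a₀ y≢v3)
    ...     | inj₁ my = trans (deg′-other (Child.≢v2 py) y≢v3) (deg≡1 T (symm a₀) (childless py my))
      where py = adj-v2 a₀ y≢v3
    ...     | inj₂ pm = contradiction (trans (sym wy) (W-parent pm (adj-v2 a₀ y≢v3))) λ ()

  M-v3 : Mprod T v3 ≡ deg T v2 * Q
  M-v3 = trans (Π-cong pointwise) (trans (Π-* at-v2 Qf) (cong (_* Q) (Π-single v2 (deg T v2))))
    where
    at-v2 : Fin n → ℕ
    at-v2 y = if does (y ≟ v2) then deg T v2 else 1
    pointwise : ∀ y → (if T v3 y then deg T y else 1) ≡ at-v2 y * Qf y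
    pointwise y with y ≟ v2
    ... | yes refl rewrite symm adj23 = sym (*-identityʳ _)
    ... | no  _    = sym (+-identityʳ _)

  -- The w_i are not adjacent to v_3 in T, so no vertex contributes both to K and to Q.
  M′-v3 : Mprod T′ v3 ≡ suc ε * (K * Q)
  M′-v3 = begin
    Mprod T′ v3                        ≡⟨ Π-cong pointwise ⟩
    Π⟨ (λ y → at-v2 y * (Kf y * Qf y)) ⟩ ≡⟨ Π-* at-v2 (λ y → Kf y * Qf y) ⟩
    Π⟨ at-v2 ⟩ * Π⟨ (λ y → Kf y * Qf y) ⟩
      ≡⟨ cong₂ _*_ (trans (Π-single v2 (deg T′ v2)) deg′-v2) (Π-* Kf Qf) ⟩
    suc ε * (K * Q) ∎
    where
    open ≡-Reasoning
    at-v2 : Fin n → ℕ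
    at-v2 y = if does (y ≟ v2) then deg T′ v2 else 1
    pointwise : ∀ y → (if T′ v3 y then deg T′ y else 1) ≡ at-v2 y * (Kf y * Qf y)
    pointwise y rewrite T′-v3 y
      with does (y ≟ v2) | does (y ≟ v3) | W y | U y | T v2 y | kind y
    ... | _ | _ | _ | _ | _ | kind-v2 refl rewrite symm adj23 = sym (*-identityʳ _)
    ... | _ | _ | _ | _ | _ | kind-v3 refl rewrite T-irrefl v3 = refl
    ... | _ | _ | _ | _ | _ | kind-W py _ _
          rewrite Child.T3≡false py | deg′-other (Child.≢v2 py) (Child.≢v3 py) =
            sym (trans (+-identityʳ _) (*-identityʳ _))
    ... | _ | _ | _ | _ | _ | kind-U py _ _ rewrite Child.T3≡false py = refl
    ... | _ | _ | _ | _ | _ | kind-other y≢v2 y≢v3 _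
          rewrite deg′-other y≢v2 y≢v3 | ∨-identityʳ (T v3 y) =
            sym (trans (+-identityʳ _) (+-identityʳ _))

  M-W : ∀ {x} → W x ≡ true → Mprod T x ≡ suc (k + ε)
  M-W {x} wx with W⇒ wx
  ... | px , pm , _ = trans (Mprod≡deg T (Child.adj2 px) leaf) deg-v2
    where
    leaf : ∀ {y} → Adj T x y → y ≢ v2 → deg T y ≡ 1
    leaf a y≢v2 with only-child px a
    ... | inj₁ e    = contradiction e y≢v2
    ... | inj₂ refl = Grandchild.leaf pm px

  M′-W : ∀ {x} → W x ≡ true → Mprod T′ x ≡ b + k
  M′-W {x} wx with W⇒ wx
  ... | px , pm , _ = trans (Mprod≡deg T′ (symm′ (T′-v3W wx)) leaf) deg′-v3
    where
    module GC = Grandchild pm px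
    leaf : ∀ {y} → Adj T′ x y → y ≢ v3 → deg T′ y ≡ 1
    leaf {y} a y≢v3 with y ≟ v2
    ... | yes refl = contradiction (trans (sym (symm′ a)) (T′-v2W wx)) λ ()
    ... | no y≢v2 with only-child px (trans (sym (T′-away wx y≢v2 y≢v3)) a)
    ...   | inj₁ e    = contradiction e y≢v2
    ...   | inj₂ refl = trans (deg′-other GC.≢v2 GC.≢v3) GC.leaf

  M-U : ∀ {x} → par x ≡ v2 → mate x ≡ v2 → Mprod T x ≡ suc (k + ε)
  M-U px mx = trans (Mprod≡deg T (Child.adj2 px) λ a y≢v2 → contradiction (childless px mx a) y≢v2) deg-v2

  M′-U : ∀ {x} → par x ≡ v2 → mate x ≡ v2 → W x ≡ false → Mprod T′ x ≡ suc ε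
  M′-U {x} px mx wx = trans
    (Mprod≡deg T′ (trans (row v2) C.adj2)
      λ {y} a y≢v2 → contradiction (childless px mx (trans (sym (row y)) a)) y≢v2) deg′-v2
    where
    module C = Child px
    row = T′-row wx C.≢v2 C.≢v3

  -- Only v_2 loses degree, and its neighbours are v_3 and its children, all excluded here.
  M-other : ∀ {x} → x ≢ v2 → x ≢ v3 → par x ≢ v2 → Mprod T x ≤ Mprod T′ x
  M-other {x} x≢v2 x≢v3 px = Π-mono pointwise
    where
    pointwise : ∀ y → (if T x y then deg T y else 1) ≤ (if T′ x y then deg T′ y else 1)
    pointwise y rewrite T′-row (par≢v2⇒¬W px) x≢v2 x≢v3 y with T x y in xy
    ... | false = ≤-refl
    ... | true with y ≟ v3 | y ≟ v2
    ...   | _       | yes refl = contradiction (trans (sym (symm xy)) (T2-false x≢v3 px)) λ ()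
    ...   | yes refl | no _     = subst (b ≤_) (sym deg′-v3) (m≤m+n b k)
    ...   | no y≢v3  | no y≢v2  = ≤-reflexive (sym (deg′-other y≢v2 y≢v3))

  2≤b : 2 ≤ b
  2≤b = 2≤deg T v2≢v4 (symm adj23) adj34

  k<K : k < K
  k<K = Σ<Π pointwise
    where
    pointwise : ∀ y → (if W y then 1 else 0) < Kf y
    pointwise y with W y in wy
    ... | true  = ≤-reflexive (sym (proj₂ (proj₂ (W⇒ wy))))
    ... | false = z<s

  Qf≥1 : ∀ y → 1 ≤ Qf y
  Qf≥1 y with does (y ≟ v2)
  ... | true  = ≤-refl
  ... | false with T v3 y in v3y
  ...   | true  = 1≤deg T (symm v3y)
  ...   | false = ≤-refl

  -- The neighbour v_4 of v_3 is also adjacent to v_5, which exists because D ≥ 5, so its factor is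
  -- at least 2.
  2≤Q : 2 ≤ Q
  2≤Q = subst (_< Q) (Σ-single v4 1) (Σ<Π pointwise)
    where
    pointwise : ∀ y → δ v4 y < Qf y
    pointwise y with y ≟ v4
    ... | no  _    = Qf≥1 y
    ... | yes refl rewrite dec-false (v4 ≟ v2) (λ e → v2≢v4 (sym e)) | adj34 =
            2≤deg T v3≢v5 (symm adj34) adj45

  -- Only the mate of v3 can be a leaf adjacent to v3.
  t : Fin n → ℕ
  t y = if does (y ≟ v2) then 0 else if does (y ≟ mate v3) then 0 else if T v3 y then 1 else 0

  t<Q : Σ⟨ t ⟩ < Q
  t<Q = Σ<Π pointwise
    where
    pointwise : ∀ y → t y < Qf y
    pointwise y with y ≟ v2
    ... | yes _ = z<s
    ... | no  _ with y ≟ mate v3 | T v3 y in v3y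
    ...   | yes _ | true  = 1≤deg T (symm v3y)
    ...   | yes _ | false = z<s
    ...   | no  _ | false = z<s
    -- Since y is not the mate of v_3, its own mate is a second neighbour.
    ...   | no y≢ | true  = 2≤deg T (λ e → y≢ (sym (mate-≡ (sym e)))) (symm v3y) (mate-adj y)

  -- Every neighbour of v_3 except v_2 and the mate of v_3 counts 1 in `t`, whose sum is less than
  -- Q.
  b≤1+Q : b ≤ suc Q
  b≤1+Q = ≤-trans (Σ-mono pointwise) (≤-trans (≤-reflexive
      (trans (Σ-δ+ v2 (λ y → δ (mate v3) y + t y)) (cong suc (Σ-δ+ (mate v3) t)))) (s≤s t<Q))
    where
    pointwise : ∀ y → (if T v3 y then 1 else 0) ≤ δ v2 y + (δ (mate v3) y + t y)
    pointwise y with does (y ≟ v2) | does (y ≟ mate v3) | T v3 y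
    ... | true  | _     | true  = s≤s z≤n
    ... | false | true  | true  = s≤s z≤n
    ... | false | false | true  = s≤s z≤n
    ... | _     | _     | false = z≤n

  -- Here the two exceptional neighbours coincide, which saves one.
  b≤Q : mate v2 ≡ v3 → b ≤ Q
  b≤Q m2 = ≤-trans (Σ-mono pointwise) (≤-trans (≤-reflexive (Σ-δ+ v2 t)) t<Q)
    where
    pointwise : ∀ y → (if T v3 y then 1 else 0) ≤ δ v2 y + t y
    pointwise y rewrite mate-≡ m2 with does (y ≟ v2) | T v3 y
    ... | true  | true  = s≤s z≤n
    ... | false | true  = s≤s z≤n
    ... | true  | false = z≤n
    ... | false | false = z≤n

  -- A leaf child of v_2 is the mate of v_2, so there is exactly one unless that mate is v_3.
  ε-cases : (ε ≡ 0 × b ≤ Q) ⊎ ε ≡ 1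
  ε-cases with mate v2 ≟ v3
  ... | yes m2 = inj₁ (n≤0⇒n≡0 (subst (ε ≤_) (Σ-single v2 0) (Σ-mono none)) , b≤Q m2)
    where
    -- The right side is the zero function in the form that `Σ-single` sums.
    none : ∀ y → (if U y then 1 else 0) ≤ (if does (y ≟ v2) then 0 else 0)
    none y with U y in uy
    ... | false = z≤n
    ... | true with U⇒ uy
    ...   | py , my = contradiction (trans (sym (mate-≡ my)) m2) (Child.≢v3 py)
  ... | no m2 = inj₂ (trans (Σ-cong one) (Σ-single (mate v2) 1))
    where
    pu : par (mate v2) ≡ v2
    pu = adj-v2 (mate-adj v2) m2
    one : ∀ y → (if U y then 1 else 0) ≡ δ (mate v2) y
    one y with y ≟ mate v2
    ... | yes refl rewrite dec-true (par (mate v2) ≟ v2) pu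
                         | dec-true (mate (mate v2) ≟ v2) (mate-mate v2) = refl
    ... | no  y≢ with U y in uy
    ...   | false = refl
    ...   | true with U⇒ uy
    ...     | _ , my = contradiction (sym (mate-≡ my)) y≢

  -- The excess of K over 1 + k and of b over 1 + ε. By `K≡` and `b≡` nothing is truncated, and all
  -- gains and losses become natural numbers.
  j gw gain-v3 loss-v2 : ℕ
  j       = K ∸ suc k
  gw      = b ∸ suc ε
  gain-v3 = Q * (ε * k + suc ε * j)
  loss-v2 = b * j + (ε + gw) * k

  K≡ : K ≡ suc k + j
  K≡ = sym (m+[n∸m]≡n k<K)

  b≡ : b ≡ suc ε + gw
  b≡ = sym (m+[n∸m]≡n (≤-trans (s≤s ε≤1) 2≤b))
    where
    ε≤1 : ε ≤ 1
    ε≤1 with ε-cases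
    ... | inj₁ (e , _) = ≤-trans (≤-reflexive e) z≤n
    ... | inj₂ e       = ≤-reflexive e

  M-v2-loss : Mprod T v2 ≤ Mprod T′ v2 + loss-v2
  M-v2-loss = ≤-reflexive (begin
    Mprod T v2                         ≡⟨ M-v2 ⟩
    b * K                              ≡⟨ cong (b *_) K≡ ⟩
    b * (suc k + j)                    ≡⟨ expand b k j ⟩
    b + (b * k + b * j)                ≡⟨ cong (λ c → b + (c * k + b * j)) b≡ ⟩
    b + ((suc ε + gw) * k + b * j)     ≡⟨ regroup b k ε gw (b * j) ⟩
    b + k + loss-v2                    ≡⟨ cong (_+ loss-v2) M′-v2 ⟨
    Mprod T′ v2 + loss-v2              ∎)
    where
    open ≡-Reasoning
    expand : ∀ b k j → b * (suc k + j) ≡ b + (b * k + b * j)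
    expand = solve-∀
    regroup : ∀ b k ε g s → b + ((suc ε + g) * k + s) ≡ b + k + (s + (ε + g) * k)
    regroup = solve-∀

  M-v3-gain : Mprod T v3 + gain-v3 ≤ Mprod T′ v3
  M-v3-gain = ≤-reflexive (begin
    Mprod T v3 + gain-v3               ≡⟨ cong (_+ gain-v3) (trans M-v3 (cong (_* Q) deg-v2)) ⟩
    suc (k + ε) * Q + gain-v3          ≡⟨ collect k ε Q j ⟩
    suc ε * ((suc k + j) * Q)          ≡⟨ cong (λ c → suc ε * (c * Q)) K≡ ⟨
    suc ε * (K * Q)                    ≡⟨ M′-v3 ⟨
    Mprod T′ v3                        ∎)
    where
    open ≡-Reasoning
    collect : ∀ k ε Q j → suc (k + ε) * Q + Q * (ε * k + suc ε * j) ≡ suc ε * ((suc k + j) * Q)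
    collect = solve-∀

  M-W-gain : ∀ {x} → W x ≡ true → Mprod T x + gw ≤ Mprod T′ x
  M-W-gain {x} wx = ≤-reflexive (begin
    Mprod T x + gw     ≡⟨ cong (_+ gw) (M-W wx) ⟩
    suc (k + ε) + gw   ≡⟨ swap k ε gw ⟩
    suc ε + gw + k     ≡⟨ cong (_+ k) b≡ ⟨
    b + k              ≡⟨ M′-W wx ⟨
    Mprod T′ x         ∎)
    where
    open ≡-Reasoning
    swap : ∀ k ε g → suc (k + ε) + g ≡ suc ε + g + k
    swap = solve-∀

  losses≤gains : loss-v2 + ε * k ≤ gain-v3 + k * gw
  losses≤gains = balance b k j gw 2≤Q b≤1+Q ε-cases

  -- Walks and eccentricities under the move

  Near : Fin n → Set
  Near x = x ≡ v2 ⊎ par x ≡ v2 ⊎ par (par x) ≡ v2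

  near? : ∀ x → Dec (Near x)
  near? x = (x ≟ v2) ⊎-dec (par x ≟ v2) ⊎-dec (par (par x) ≟ v2)

  near-h : ∀ {x} → Near x → 3 + d ≤ h x
  near-h (inj₁ refl)       = ≤-reflexive (sym h-v2)
  near-h (inj₂ (inj₁ p))   = ≤-trans (n≤1+n _) (≤-reflexive (sym (Child.height p)))
  near-h (inj₂ (inj₂ p))   = ≤-trans (m≤n+m _ 2) (≤-reflexive (sym (Grandchild.height refl p)))

  far-v3 : ¬ Near v3
  far-v3 nr = n≮n _ (subst (3 + d ≤_) h-v3 (near-h nr))

  -- The near side is the whole branch at v_2, as grandchildren of v_2 are leaves; its only edge to
  -- the rest is v_2 v_3.
  cross : ∀ {x z} → Near x → ¬ Near z → Adj T x z → x ≡ v2 × z ≡ v3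
  cross nx fz xz with edge xz
  cross (inj₁ refl)     fz xz | inj₁ (p , _) = refl , trans (sym p) par-v2
  cross (inj₂ (inj₁ q)) fz xz | inj₁ (p , _) = contradiction (inj₁ (trans (sym p) q)) fz
  cross (inj₂ (inj₂ q)) fz xz | inj₁ (refl , _) = contradiction (inj₂ (inj₁ q)) fz
  cross (inj₁ refl)     fz xz | inj₂ (p , _) = contradiction (inj₂ (inj₁ p)) fz
  cross (inj₂ (inj₁ q)) fz xz | inj₂ (refl , _) = contradiction (inj₂ (inj₂ q)) fz
  cross {x} (inj₂ (inj₂ q)) fz xz | inj₂ (p , _) with Grandchild.only refl q xz
  ... | refl = contradiction (inj₂ (inj₁ q)) fz

  h-adj : ∀ {x y} → Adj T x y → h x ≤ suc (h y)
  h-adj xy with edge xy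
  ... | inj₁ (_ , e) = ≤-reflexive e
  ... | inj₂ (_ , e) = ≤-trans (n≤1+n _) (≤-trans (≤-reflexive (sym e)) (n≤1+n _))

  -- The walk leaves the near side by v_2 v_3. Each step lowers the height by at most one, so h x -
  -- h v_3 steps are spent before v_3; the bound is additive to avoid subtraction.
  through-v3 : ∀ {l x y} → Near x → ¬ Near y → Walk l x y →
               ∃ λ i → Walk i v3 y × i + h x ≤ l + (2 + d)
  through-v3 nx fy [] = contradiction nx fy
  through-v3 {suc l} {x} nx fy (_∷_ {v = z} xz p) with near? z
  ... | no fz with cross nx fz xz
  ...   | refl , refl = l , p , ≤-reflexive (trans (cong (l +_) h-v2) (+-suc l (2 + d)))
  through-v3 {suc l} {x} nx fy (_∷_ {v = z} xz p) | yes nz with through-v3 nz fy p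
  ...   | i , q , le = i , q , (begin
          i + h x              ≤⟨ +-monoʳ-≤ i (h-adj xz) ⟩
          i + suc (h z)        ≡⟨ +-suc i (h z) ⟩
          suc (i + h z)        ≤⟨ s≤s le ⟩
          suc (l + (2 + d))    ∎)
    where open ≤-Reasoning

  far⇒¬W : ∀ {x} → ¬ Near x → W x ≡ false
  far⇒¬W fx = par≢v2⇒¬W λ p → fx (inj₂ (inj₁ p))

  -- Collapsing the near side onto v3 turns walks of T into walks of T′ that are no longer.
  retract : Fin n → Fin n
  retract x with near? x
  ... | yes _ = v3
  ... | no  _ = x

  retract-far : ∀ {x} → ¬ Near x → retract x ≡ x
  retract-far {x} fx with near? x
  ... | yes nx = contradiction nx fx
  ... | no  _  = refl

  retract-walk : ∀ {l x y} → ¬ Near y → Walk l x y → ∃ λ i → Walk′ i (retract x) y × i ≤ l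
  retract-walk {y = y} fy [] = 0 , subst (λ z → Walk′ 0 z y) (sym (retract-far fy)) []′ , z≤n
  retract-walk {y = y} fy (_∷_ {u = x} {v = z} xz p) with retract-walk fy p
  ... | i , q , le with near? x | near? z
  ...   | yes _  | yes _  = i , q , m≤n⇒m≤1+n le
  ...   | no fx  | no fz  = suc i , trans (T′-unmoved (far⇒¬W fx) (far⇒¬W fz)) xz ∷′ q , s≤s le
  ...   | yes nx | no fz  with cross nx fz xz
  ...     | _ , refl = i , q , m≤n⇒m≤1+n le
  retract-walk {y = y} fy (_∷_ {u = x} {v = z} xz p) | i , q , le | no fx | yes nz with cross nz fx (symm xz)
  ...     | _ , refl = i , q , m≤n⇒m≤1+n le

  walk-far : ∀ {l x y} → ¬ Near x → ¬ Near y → Walk l x y → ∃ λ i → Walk′ i x y × i ≤ l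
  walk-far {y = y} fx fy p with retract-walk fy p
  ... | i , q , le = i , subst (λ z → Walk′ i z y) (retract-far fx) q , le

  hang-child : ∀ {x} → par x ≡ v2 → ∃ λ i → Walk′ i v3 x × i ≤ 2
  hang-child {x} px with W x in wx
  ... | true  = 1 , T′-v3W wx ∷′ []′ , s≤s z≤n
  ... | false = 2 , symm′ adj23′ ∷′ trans (T′-unmoved W-v2 wx) (symm (Child.adj2 px)) ∷′ []′ , ≤-refl

  -- In T′ the branch lies within two steps of v_3, and no vertex of it is farther from v_3 than its
  -- height difference.
  hang : ∀ {x} → Near x → ∃ λ i → Walk′ i v3 x × i ≤ 2 × i + (2 + d) ≤ h x
  hang (inj₁ refl)     = 1 , symm′ adj23′ ∷′ []′ , s≤s z≤n , ≤-reflexive (sym h-v2)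
  hang (inj₂ (inj₁ p)) with hang-child p
  ... | i , q , i≤2 = i , q , i≤2 , ≤-trans (+-monoˡ-≤ (2 + d) i≤2) (≤-reflexive (sym (Child.height p)))
  hang {x} (inj₂ (inj₂ p)) = 2 , T′-v3W wW ∷′ symm′ xw ∷′ []′ , ≤-refl ,
      ≤-trans (n≤1+n _) (≤-reflexive (sym GC.height))
    where
    module GC = Grandchild {x} refl p
    wW : W (par x) ≡ true
    wW = W-parent refl p
    xw : Adj T′ x (par x)
    xw = symm′ (trans (T′-away wW GC.≢v2 GC.≢v3) (symm GC.adj))

  geodesic : ∀ x y → Walk (dist T x y) x y
  geodesic x y = shortest x y (≤-<-trans (dist≤D x y) D<n)

  h≤ecc : ∀ x → h x ≤ ecc T x
  h≤ecc x = ≤-trans (h≤dist x) (dist≤ecc x r)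

  -- The walk is cut at v_3: its far part is retracted, and its near part is replaced by the walk
  -- from `hang`, which is no longer.
  near-far : ∀ {l x y} → Near x → ¬ Near y → Walk l x y → ∃ λ i → Walk′ i x y × i ≤ l
  near-far {l} {x} nx fy p with hang nx | through-v3 nx fy p
  ... | i , q , _ , i+ | m , s , m+ with walk-far far-v3 fy s
  ...   | m′ , s′ , m′≤m = i + m′ , rev′ q ++′ s′ , +-cancelʳ-≤ (2 + d) (i + m′) l (begin
          i + m′ + (2 + d)    ≤⟨ +-monoˡ-≤ (2 + d) (+-monoʳ-≤ i m′≤m) ⟩
          i + m + (2 + d)     ≡⟨ rot i m (2 + d) ⟩
          m + (i + (2 + d))   ≤⟨ +-monoʳ-≤ m i+ ⟩
          m + h x             ≤⟨ m+ ⟩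
          l + (2 + d)         ∎)
    where
    open ≤-Reasoning
    rot : ∀ a b c → a + b + c ≡ b + (a + c)
    rot = solve-∀

  -- Bounded by the eccentricity and not by the distance, because distances inside the branch can
  -- grow: v_2 and w_i are no longer adjacent.
  walk≤ecc : ∀ x y → ∃ λ i → Walk′ i x y × i ≤ ecc T x
  walk≤ecc x y with near? x | near? y
  ... | no fx  | no fy  with walk-far fx fy (geodesic x y)
  ...   | i , q , le = i , q , ≤-trans le (dist≤ecc x y)
  walk≤ecc x y | yes nx | no fy with near-far nx fy (geodesic x y)
  ...   | i , q , le = i , q , ≤-trans le (dist≤ecc x y)
  walk≤ecc x y | no fx | yes ny with near-far ny fx (reverseʷ T-sym (geodesic x y))
  ...   | i , q , le = i , rev′ q , ≤-trans le (dist≤ecc x y)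
  walk≤ecc x y | yes nx | yes ny with hang nx | hang ny
  -- The detour through v_3 has length at most i + 2 ≤ i + h v_3 ≤ h x ≤ ε(x).
  ...   | i , p , _ , i+ | i′ , q , i′≤2 , _ = i + i′ , rev′ p ++′ q ,
          ≤-trans (+-monoʳ-≤ i (≤-trans i′≤2 (m≤m+n 2 d))) (≤-trans i+ (h≤ecc x))

  dist′≤ecc : ∀ x y → dist T′ x y ≤ ecc T x
  dist′≤ecc x y with walk≤ecc x y
  ... | _ , p , le = ≤-trans (dist′≤ p) le

  ecc′≤ecc : ∀ x → ecc T′ x ≤ ecc T x
  ecc′≤ecc x = ecc′≤ x (dist′≤ecc x)

  -- Every walk from v0 to the far side spends three steps before v3.
  ecc′-close : ∀ {x i} → i ≤ 1 → Walk′ i x v3 → ecc T′ x ≤ 3 + d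
  ecc′-close {x} {i} i≤1 p = ecc′≤ x bound
    where
    near-v0 : Near v0
    near-v0 = inj₂ (inj₂ (trans (cong par par-v0) par-v1))
    bound : ∀ y → dist T′ x y ≤ 3 + d
    bound y with near? y
    ... | yes ny with hang ny
    ...   | i′ , q , i′≤2 , _ = ≤-trans (dist′≤ (p ++′ q)) (≤-trans (+-mono-≤ i≤1 i′≤2) (m≤m+n 3 d))
    bound y | no fy with through-v3 near-v0 fy (geodesic v0 y)
    ...   | m , q , le with walk-far far-v3 fy q
    ...     | m′ , q′ , m′≤m = ≤-trans (dist′≤ (p ++′ q′))
              (+-mono-≤ i≤1 (≤-trans m′≤m (+-cancelʳ-≤ (5 + d) m (2 + d) (begin
                m + (5 + d)              ≡⟨ cong (m +_) (Grandchild.height par-v0 par-v1) ⟨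
                m + h v0                 ≤⟨ le ⟩
                dist T v0 y + (2 + d)    ≤⟨ +-monoˡ-≤ (2 + d) (dist≤D v0 y) ⟩
                5 + d + (2 + d)          ≡⟨ +-comm (5 + d) (2 + d) ⟩
                2 + d + (5 + d)          ∎))))
      where open ≤-Reasoning

  -- Termwise comparison of the two sums

  ecc′>0 : ∀ x → 0 < ecc T′ x
  ecc′>0 x = <-≤-trans (dist′≢0 (adj≢ (mate-adj x)) (≤-<-trans (dist′≤ecc x (mate x)) ecc<n))
                        (dist′≤ecc′ x (mate x))
    where
    ecc<n : ecc T x < n
    ecc<n = ≤-<-trans (ecc≤ x (dist≤D x)) D<n

  instance
    ecc′-nonZero : ∀ {x} → NonZero (ecc T′ x)
    ecc′-nonZero {x} = >-nonZero (ecc′>0 x)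

    ecc-nonZero : ∀ {x} → NonZero (ecc T x)
    ecc-nonZero {x} = >-nonZero (<-≤-trans (ecc′>0 x) (ecc′≤ecc x))

  gain loss : Fin n → ℕ
  gain y = if does (y ≟ v3) then gain-v3 else (if W y then gw else 0)
  loss y = if does (y ≟ v2) then loss-v2 else (if U y then k else 0)

  Σ-gain : Σ⟨ gain ⟩ ≡ gain-v3 + k * gw
  Σ-gain = trans (Σ-cong pointwise)
    (trans (Σ-+ (λ y → if does (y ≟ v3) then gain-v3 else 0) (λ y → if W y then gw else 0))
           (cong₂ _+_ (Σ-single v3 gain-v3) (Σ-if W gw)))
    where
    pointwise : ∀ y → gain y ≡ (if does (y ≟ v3) then gain-v3 else 0) + (if W y then gw else 0)
    pointwise y with y ≟ v3
    ... | yes refl rewrite W-v3 = sym (+-identityʳ _)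
    ... | no  _    = refl

  Σ-loss : Σ⟨ loss ⟩ ≡ loss-v2 + ε * k
  Σ-loss = trans (Σ-cong pointwise)
    (trans (Σ-+ (λ y → if does (y ≟ v2) then loss-v2 else 0) (λ y → if U y then k else 0))
           (cong₂ _+_ (Σ-single v2 loss-v2) (Σ-if U k)))
    where
    pointwise : ∀ y → loss y ≡ (if does (y ≟ v2) then loss-v2 else 0) + (if U y then k else 0)
    pointwise y with does (y ≟ v2) | does (y ≟ v3) | W y | U y | T v2 y | kind y
    ... | _ | _ | _ | _ | _ | kind-v2 _        = sym (+-identityʳ _)
    ... | _ | _ | _ | _ | _ | kind-v3 _        = refl
    ... | _ | _ | _ | _ | _ | kind-W _ _ _     = refl
    ... | _ | _ | _ | _ | _ | kind-U _ _ _     = refl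
    ... | _ | _ | _ | _ | _ | kind-other _ _ _ = refl

  -- Gains are added to the terms of T and losses to those of T′, all over D - 2. Together with Σ
  -- loss ≤ Σ gain, a termwise comparison then suffices.
  before after : Fin n → ℚ
  before y = Mprod T y ÷ ecc T y ℚ.+ gain y ÷ (3 + d)
  after  y = Mprod T′ y ÷ ecc T′ y ℚ.+ loss y ÷ (3 + d)

  -- The eccentricity of w_i was at least its height D - 1 and is now at most D - 2.
  W-strict : ∀ {y} → W y ≡ true →
             Mprod T y ÷ ecc T y ℚ.+ gw ÷ (3 + d) ℚ.< Mprod T′ y ÷ ecc T′ y ℚ.+ 0 ÷ (3 + d)
  W-strict {y} wy = ÷-gain-< {{>-nonZero (subst (0 <_) (sym (M-W wy)) z<s)}} (M-W-gain wy)
      (≤-<-trans close (subst (_≤ ecc T y) (Child.height (proj₁ (W⇒ wy))) (h≤ecc y))) close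
    where
    close : ecc T′ y ≤ 3 + d
    close = ecc′-close ≤-refl (symm′ (T′-v3W wy) ∷′ []′)

  before<after : ∀ {y} → W y ≡ true → before y ℚ.< after y
  before<after {y} wy = subst₂ ℚ._<_ (cong (λ g → Mprod T y ÷ ecc T y ℚ.+ g ÷ (3 + d)) (sym gain≡))
    (cong (λ l → Mprod T′ y ÷ ecc T′ y ℚ.+ l ÷ (3 + d)) (sym loss≡)) (W-strict wy)
    where
    gain≡ : gain y ≡ gw
    gain≡ with does (y ≟ v2) | does (y ≟ v3) | W y | U y | T v2 y | kind y
    ... | _ | _ | _ | _ | _ | kind-W _ _ _ = refl
    loss≡ : loss y ≡ 0
    loss≡ with does (y ≟ v2) | does (y ≟ v3) | W y | U y | T v2 y | kind y
    ... | _ | _ | _ | _ | _ | kind-W _ _ _ = refl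

  before≤after : ∀ y → before y ℚ.≤ after y
  before≤after y with does (y ≟ v2) | does (y ≟ v3) | W y in wy | U y | T v2 y | kind y
  ... | _ | _ | _ | _ | _ | kind-v2 refl =
        ÷-loss M-v2-loss (ecc′≤ecc v2) (≤-trans (≤-reflexive (sym h-v2)) (h≤ecc v2))
  ... | _ | _ | _ | _ | _ | kind-v3 refl =
        ÷-gain M-v3-gain (ecc′≤ecc v3) (ecc′-close z≤n []′)
  ... | _ | _ | _ | _ | _ | kind-W _ _ _ = ℚ.<⇒≤ (W-strict wy)
  ... | _ | _ | _ | _ | _ | kind-U py my _ =
        ÷-loss (≤-reflexive (trans (M-U py my) (trans (cong suc (+-comm k ε))
                 (cong (_+ k) (sym (M′-U py my wy))))))
               (ecc′≤ecc y) (≤-trans (n≤1+n _) (subst (_≤ ecc T y) (Child.height py) (h≤ecc y)))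
  ... | _ | _ | _ | _ | _ | kind-other y≢v2 y≢v3 py =
        ℚ.+-monoˡ-≤ (0 ÷ (3 + d)) (÷-mono (M-other y≢v2 y≢v3 py) (ecc′≤ecc y))

  ξ<ξ′ : ξac T ℚ.< ξac T′
  -- If the index did not grow, adding Σ loss ≤ Σ gain would contradict `total`.
  ξ<ξ′ = ℚ.≰⇒> λ ξ′≤ξ → ℚ.<-irrefl refl (ℚ.<-≤-trans total (ℚ.+-mono-≤ ξ′≤ξ Σloss≤Σgain))
    where
    split : ∀ (G : Graph n) .{{_ : ∀ {x} → NonZero (ecc G x)}} (f : Fin n → ℕ) →
            Σℚ (λ y → Mprod G y ÷ ecc G y ℚ.+ f y ÷ (3 + d)) ≡ ξac G ℚ.+ Σ⟨ f ⟩ ÷ (3 + d)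
    split G f = trans (Σℚ-+ (λ y → Mprod G y ÷ ecc G y) (λ y → f y ÷ (3 + d)))
      (cong₂ ℚ._+_ (Σℚ-cong λ y → frac≡÷ (Mprod G y) (ecc G y)) (Σℚ-÷ f (3 + d)))
      where
      frac≡÷ : ∀ a e .{{_ : NonZero e}} → a ÷ e ≡ frac G a e
      frac≡÷ a (suc e) = ÷-def a e
    total : ξac T ℚ.+ Σ⟨ gain ⟩ ÷ (3 + d) ℚ.< ξac T′ ℚ.+ Σ⟨ loss ⟩ ÷ (3 + d)
    total = subst₂ ℚ._<_ (split T gain) (split T′ loss)
      -- The child v_0 of v_1 makes v_1 one of the w_i, hence a strict term.
      (Σℚ-mono-< v1 before≤after (before<after (W-parent par-v0 par-v1)))
    Σloss≤Σgain : Σ⟨ loss ⟩ ÷ (3 + d) ℚ.≤ Σ⟨ gain ⟩ ÷ (3 + d)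
    Σloss≤Σgain = ÷-mono (subst₂ _≤_ (sym Σ-loss) (sym Σ-gain) losses≤gains) (≤-refl {3 + d})

  -- T′ is a tree with the same perfect matching

  T′-irrefl : ∀ x → T′ x x ≡ false
  T′-irrefl x with W x in wx
  ... | true  = trans (T′-away wx (Child.≢v2 px) (Child.≢v3 px)) (T-irrefl x)
    where px = proj₁ (W⇒ wx)
  ... | false = trans (T′-unmoved wx wx) (T-irrefl x)

  connected′ : Connected T′
  connected′ x y with walk≤ecc x y
  ... | i , p , _ = i , toB′ p

  -- Used with the old heights: w_i at height D - 1 now hangs from v_3 at height D - 3.
  par′ : Fin n → Fin n
  par′ x = if W x then v3 else par x

  moved-edge : ∀ {x y} → W x ≡ true → Adj T′ x y →
               (par′ x ≡ y × h y < h x) ⊎ (par′ y ≡ x × h x < h y)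
  moved-edge {x} {y} wx xy with W⇒ wx
  ... | px , pm , _ with y ≟ v3 | y ≟ v2
  ...   | yes refl | _ = inj₁ (cong (if_then v3 else par x) wx ,
            subst₂ _<_ (sym h-v3) (sym (Child.height px)) (n≤1+n _))
  ...   | no _     | yes refl = contradiction (trans (sym (symm′ xy)) (T′-v2W wx)) λ ()
  ...   | no y≢v3  | no y≢v2 with only-child px (trans (sym (T′-away wx y≢v2 y≢v3)) xy)
  ...     | inj₁ e    = contradiction e y≢v2
  ...     | inj₂ refl = inj₂ (trans (cong (if_then v3 else par y) (par≢v2⇒¬W GC.par≢v2)) pm ,
              subst₂ _<_ (sym (Child.height px)) (sym GC.height) ≤-refl)
    where module GC = Grandchild pm px

  parental′ : Parental T′ h par′
  parental′ {x} {y} xy = go (W x) (W y) refl refl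
    where
    go : ∀ s t → W x ≡ s → W y ≡ t → (par′ x ≡ y × h y < h x) ⊎ (par′ y ≡ x × h x < h y)
    go true  _     wx wy = moved-edge wx xy
    go false true  wx wy = Sum.swap (moved-edge wy (symm′ xy))
    go false false wx wy with edge (trans (sym (T′-unmoved wx wy)) xy)
    ... | inj₁ (p , e) = inj₁ (trans (cong (if_then v3 else par x) wx) p , ≤-reflexive (sym e))
    ... | inj₂ (p , e) = inj₂ (trans (cong (if_then v3 else par y) wy) p , ≤-reflexive (sym e))

  -- The mate of w_i is its own leaf child, so this matching edge is not among those deleted.
  W-mate-adj′ : ∀ {x} → W x ≡ true → Adj T′ x (mate x)
  W-mate-adj′ {x} wx with W⇒ wx
  ... | px , pm , _ = trans (T′-away wx (Grandchild.≢v2 pm px) (Grandchild.≢v3 pm px)) (mate-adj x)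

  mate-adj′ : ∀ x → Adj T′ x (mate x)
  mate-adj′ x with W x in wx | W (mate x) in wm
  ... | true  | _     = W-mate-adj′ wx
  ... | false | true  = symm′ (subst (Adj T′ (mate x)) (mate-mate x) (W-mate-adj′ wm))
  ... | false | false = trans (T′-unmoved wx wm) (mate-adj x)

  isTree′ : IsTree T′
  isTree′ = (T′-sym , T′-irrefl) , connected′ , ParentalAcyclic.acyclic parental′

-- Properties of the concrete move

module Move {n : ℕ} (T : Graph n) (T-sym : ∀ u v → T u v ≡ T v u) (T-irrefl : ∀ u → T u u ≡ false)
            {a b : Fin n} (a≢b : a ≢ b) where

  W : Fin n → Bool
  W = isW T a b

  W-elim : ∀ {x} → W x ≡ true → Adj T a x × x ≢ b × deg T x ≡ 2
  W-elim {x} wx with T a x | x ≟ b | deg T x ≡ᵇ 2 in eq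
  ... | true | no x≢b | true = refl , x≢b , ≡ᵇ⇒≡ (deg T x) 2 (Equivalence.from T-≡ eq)

  W-intro : ∀ {x} → Adj T a x → x ≢ b → deg T x ≡ 2 → W x ≡ true
  W-intro {x} ax x≢b d2
    rewrite ax | dec-false (x ≟ b) x≢b | dec-true (deg T x ℕ.≟ 2) d2 = refl

  W≢a : ∀ {x} → W x ≡ true → x ≢ a
  W≢a wa refl = contradiction (trans (sym (proj₁ (W-elim wa))) (T-irrefl a)) λ ()

  -- The branching of `move` with its tests as arguments, so that single tests can be replaced by
  -- their values.
  choose : (xa ya xb yb wx wy t : Bool) → Bool
  choose xa ya xb yb wx wy t =
    if (xa ∧ wy) ∨ (ya ∧ wx) then false else if (xb ∧ wy) ∨ (yb ∧ wx) then true else t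

  move-sym : ∀ x y → move T a b x y ≡ move T a b y x
  move-sym x y
    rewrite T-sym x y
          | ∨-comm (does (x ≟ a) ∧ W y) (does (y ≟ a) ∧ W x)
          | ∨-comm (does (x ≟ b) ∧ W y) (does (y ≟ b) ∧ W x) = refl

  move-unmoved : ∀ {x y} → W x ≡ false → W y ≡ false → move T a b x y ≡ T x y
  move-unmoved {x} {y} wx wy = trans
    (cong₂ (λ p q → choose (does (x ≟ a)) (does (y ≟ a)) (does (x ≟ b)) (does (y ≟ b)) p q (T x y)) wx wy)
    (none (does (x ≟ a)) (does (y ≟ a)) (does (x ≟ b)) (does (y ≟ b)))
    where
    none : ∀ xa ya xb yb → choose xa ya xb yb false false (T x y) ≡ T x y
    none xa ya xb yb rewrite ∧-zeroʳ xa | ∧-zeroʳ ya | ∧-zeroʳ xb | ∧-zeroʳ yb = refl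

  move-moved : ∀ {x} → W x ≡ true → ∀ y →
               move T a b x y ≡ (does (y ≟ b) ∨ (T x y ∧ not (does (y ≟ a))))
  move-moved {x} wx y = trans
    (cong₂ (λ p q → choose p (does (y ≟ a)) q (does (y ≟ b)) (W x) (W y) (T x y))
           (dec-false (x ≟ a) (W≢a wx)) (dec-false (x ≟ b) (proj₁ (proj₂ (W-elim wx)))))
    (trans (cong (λ p → choose false (does (y ≟ a)) false (does (y ≟ b)) p (W y) (T x y)) wx) cases)
    where
    cases : choose false (does (y ≟ a)) false (does (y ≟ b)) true (W y) (T x y)
          ≡ does (y ≟ b) ∨ (T x y ∧ not (does (y ≟ a)))
    cases with y ≟ a | y ≟ b
    ... | yes refl | yes e  = contradiction e a≢b
    ... | yes refl | no _   = sym (∧-zeroʳ (T x y))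
    ... | no _     | yes _  = refl
    ... | no _     | no _ with T x y
    ...   | true  = refl
    ...   | false = refl

-- The configuration of a diametric path

module _ {n : ℕ} {T : Graph n} (tree : IsTree T) (matching : HasPerfectMatching T) (d : ℕ)
         (dist≤D : ∀ u v → dist T u v ≤ 5 + d)
         {P : ℕ → Fin n} (path : IsDiametricPath T (5 + d) P) where

  private
    simple = proj₁ tree
    acyclic = proj₂ (proj₂ tree)
    P-adj = proj₁ path
    P-injective = proj₁ (proj₂ path)

    mate : Fin n → Fin n
    mate u = proj₁ (proj₂ (proj₂ (proj₂ matching)) u)

    mate-matched : ∀ u → proj₁ matching u (mate u) ≡ true
    mate-matched u = proj₁ (proj₂ (proj₂ (proj₂ (proj₂ matching)) u))

    mate-unique : ∀ {u w} → proj₁ matching u w ≡ true → w ≡ mate u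
    mate-unique {u} {w} = proj₂ (proj₂ (proj₂ (proj₂ (proj₂ matching)) u)) w

    -- The D + 1 vertices of P are distinct. The bound keeps all distances in the range searched by
    -- `dist`.
    D<n : 5 + d < n
    D<n = injective⇒≤ {f = λ (i : Fin (6 + d)) → P (toℕ i)} λ {i} {j} e →
      toℕ-injective (P-injective (toℕ i) (toℕ j) (s≤s⁻¹ (toℕ<n i)) (s≤s⁻¹ (toℕ<n j)) e)

    open Walks T
    open Rooted T simple acyclic (λ u v → ≤-<-trans (dist≤D u v) D<n) (P (5 + d))

    tail-walk : ∀ j i → i + j ≡ 5 + d → Walk j (P i) (P (5 + d))
    tail-walk zero    i e = subst (λ m → Walk 0 (P i) (P m)) (trans (sym (+-identityʳ i)) e) []
    tail-walk (suc j) i e =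
      P-adj i (subst (suc i ≤_) (trans (sym (+-suc i j)) e) (s≤s (m≤m+n i j)))
      ∷ tail-walk j (suc i) (trans (sym (+-suc i j)) e)

    -- From height D at v_0, the height drops by at most one per edge of P.
    h-lower : ∀ i → i ≤ 5 + d → 5 + d ≤ i + h (P i)
    h-lower zero    _  = ≤-reflexive (sym (proj₂ (proj₂ path)))
    h-lower (suc i) le = ≤-trans (h-lower i (<⇒≤ le))
      (≤-trans (+-monoʳ-≤ i (h-adj (P-adj i le))) (≤-reflexive (+-suc i _)))

    h-P : ∀ i j → i + j ≡ 5 + d → h (P i) ≡ j
    h-P i j e = ≤-antisym (dist≤ (tail-walk j i e))
      (+-cancelˡ-≤ i j (h (P i)) (subst (_≤ i + h (P i)) (sym e) (h-lower i (subst (i ≤_) e (m≤m+n i j)))))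

    par-P : ∀ i j → i + suc j ≡ 5 + d → par (P i) ≡ P (suc i)
    par-P i j e = proj₁ (toParent (P-adj i (subst (suc i ≤_) e′ (s≤s (m≤m+n i j))))
      (subst₂ _≤_ (sym (h-P (suc i) j e′)) (sym (h-P i (suc j) e)) (n≤1+n j)))
      where
      e′ : suc i + j ≡ 5 + d
      e′ = trans (sym (+-suc i j)) e

    P≢ : ∀ {i j} → i ≤ 5 → j ≤ 5 → i ≢ j → P i ≢ P j
    P≢ i≤5 j≤5 i≢j e = i≢j (P-injective _ _ (≤-trans i≤5 (m≤m+n 5 d)) (≤-trans j≤5 (m≤m+n 5 d)) e)

    2≤5 : 2 ≤ 5
    2≤5 = s≤s (s≤s z≤n)

    3≤5 : 3 ≤ 5
    3≤5 = s≤s (s≤s (s≤s z≤n))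

    module Mv = Move T (proj₁ simple) (proj₂ simple) (P≢ 2≤5 3≤5 λ ())

  configuration : Configuration T (move T (P 2) (P 3))
  configuration = record
    { d          = d
    ; T-sym      = proj₁ simple
    ; T-irrefl   = proj₂ simple
    ; D<n        = D<n
    ; dist≤D     = dist≤D
    ; mate       = mate
    ; mate-adj   = λ x → proj₁ (proj₂ (proj₂ matching)) x (mate x) (mate-matched x)
    ; mate-mate  = λ x → sym (mate-unique (trans (proj₁ (proj₂ matching) (mate x) x) (mate-matched x)))
    ; r          = P (5 + d)
    ; h          = h
    ; par        = par
    ; h≤dist     = λ _ → ≤-refl
    ; h-r        = dist-self _
    ; edge       = edge
    ; par-r      = par-r
    ; par-spec   = par-spec
    ; v0 = P 0 ; v1 = P 1 ; v2 = P 2 ; v3 = P 3 ; v4 = P 4 ; v5 = P 5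
    ; par-v0     = par-P 0 (4 + d) refl
    ; par-v1     = par-P 1 (3 + d) refl
    ; par-v2     = par-P 2 (2 + d) refl
    ; adj34      = P-adj 3 (m≤m+n 4 (suc d))
    ; adj45      = P-adj 4 (m≤m+n 5 d)
    ; v2≢v4      = P≢ 2≤5 (s≤s (s≤s (s≤s (s≤s z≤n)))) λ ()
    ; v3≢v5      = P≢ 3≤5 ≤-refl λ ()
    ; h-v2       = h-P 2 (3 + d) refl
    ; W          = Mv.W
    ; W-elim     = Mv.W-elim
    ; W-intro    = Mv.W-intro
    ; T′-sym     = Mv.move-sym
    ; T′-unmoved = Mv.move-unmoved
    ; T′-moved   = Mv.move-moved
    }

  open Comparison configuration

  conclusion : IsTree (move T (P 2) (P 3)) × HasPerfectMatching (move T (P 2) (P 3))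
             × ξac T ℚ.< ξac (move T (P 2) (P 3))
  conclusion = isTree′ ,
    (proj₁ matching , proj₁ (proj₂ matching) ,
      -- The matching of T is kept: a matched pair is a vertex and its mate.
      (λ u v uv → subst (Adj (move T (P 2) (P 3)) u) (sym (mate-unique uv)) (mate-adj′ u)) ,
      proj₂ (proj₂ (proj₂ matching))) ,
    ξ<ξ′

theorem12 : ∀ {n : ℕ} (T : Graph n) → IsTree T → HasPerfectMatching T →
    (D : ℕ) → IsDiameter T D → 5 ≤ D →
    (P : ℕ → Fin n) → IsDiametricPath T D P →
    IsTree (move T (P 2) (P 3)) × HasPerfectMatching (move T (P 2) (P 3))
      × ξac T ℚ.< ξac (move T (P 2) (P 3))
theorem12 T tree matching D (dist≤D , _) 5≤D P path with m≤n⇒∃[o]m+o≡n 5≤D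
... | d , refl = conclusion tree matching d dist≤D path
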